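{- For all $\epsilon,\alpha,\delta>0$ there is an $(\epsilon,(1+\alpha)\epsilon,\delta)$-local reconstructor for the property of (undirected) connectivity, with query complexity $O\!\left(\frac{1}{\delta\alpha\epsilon}\right)$.
   Context: Model (general sparse graph model): graphs have $n$ vertices; $m$ is a fixed upper bound on the number of edges, with $m=\Omega(n)$. A neighbor oracle for $G$ answers, for a vertex $v$, either $\deg(v)$ or the $i$-th neighbor of $v$ (w.r.t. a fixed ordering); each answer is one query. An edge oracle for $G$ returns $1$ on $(u,v)$ iff $(u,v)\in E(G)$. $\mathrm{dist}(G_1,G_2)$ is the number of unordered vertex pairs that are an edge in exactly one of $G_1,G_2$, divided by $m$; $\mathrm{dist}(G,\mathcal{P})=\min_{G'\in\mathcal{P}}\mathrm{dist}(G,G')$, and $G$ is $\epsilon$-close to $\mathcal{P}$ if this is $\le\epsilon$. An $(\epsilon_1,\epsilon_2,\delta)$-local reconstructor for a property $\mathcal{P}$ is a randomized algorithm $\mathcal{R}$ with neighbor-oracle access to a graph $G$ that is $\epsilon_1$-close to $\mathcal{P}$ such that (i) $\mathcal{R}$ makes $o(m)$ neighbor-oracle queries per query to $\mathcal{R}$, and (ii) with probability at least $1-\delta$ over the coin tosses of $\mathcal{R}$ there is $\widetilde G\in\mathcal{P}$ with $\mathrm{dist}(G,\widetilde G)\le\epsilon_2$ such that $\mathcal{R}$ is an edge oracle for $\widetilde G$. The query complexity is the number of neighbor-oracle queries made on any query $(u,v)$.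
   Formalization: The reconstructor may also ask, as one charged query, whether the queried pair (u,v) is an edge of G; with neighbor queries alone the bound fails (path plus dense random graph on √n vertices). ε, α, δ and the constants are rational, which loses nothing. -}

module Defs where

open import Data.Bool.Base using (Bool; true; false; T; _xor_)
open import Data.Fin.Base using (Fin)
open import Data.Fin.Properties using (_<?_)
open import Data.Fin.Subset using (Subset; ∣_∣) renaming (_∈_ to _∈ₛ_)
open import Data.Integer.Base using (+_)
open import Data.List.Base
  using (List; []; _∷_; length; filter; filterᵇ; allFin; cartesianProduct)
open import Data.List.Membership.Propositional using (_∈_)
open import Data.List.Relation.Unary.Unique.Propositional using (Unique)
open import Data.Maybe.Base using (Maybe; nothing; just)
open import Data.Nat.Base as ℕ using (ℕ; zero; suc)
open import Data.Product.Base using (Σ-syntax; _×_; uncurry)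
open import Data.Rational.Base
  using (ℚ; 0ℚ; 1ℚ; _/_; _*_; _-_; _≤_; _<_; 1/_; >-nonZero; positive)
open import Data.Rational.Properties using (positive⁻¹; pos*pos⇒pos)
open import Function.Bundles using (_⇔_)
open import Relation.Binary.Construct.Closure.ReflexiveTransitive using (Star)
open import Relation.Binary.PropositionalEquality using (_≡_)

fromℕ : ℕ → ℚ
fromℕ k = + k / 1

reciprocal : (p : ℚ) → 0ℚ < p → ℚ
reciprocal p p>0 = (1/ p) {{>-nonZero p>0}}

*-pos : ∀ {p q} → 0ℚ < p → 0ℚ < q → 0ℚ < p * q
*-pos {p} {q} p>0 q>0 =
  positive⁻¹ (p * q) {{pos*pos⇒pos p {{positive p>0}} q {{positive q>0}}}}

------------------------------------------------------------------------
-- Graphs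

record Graph (n : ℕ) : Set where
  field
    adj         : Fin n → Fin n → Bool
    symmetric   : ∀ u v → adj u v ≡ adj v u
    irreflexive : ∀ v → adj v v ≡ false

open Graph public

Property : Set₁
Property = ∀ {n} → Graph n → Set

Connected : Property
Connected {n} G = (u v : Fin n) → Star (λ x y → T (adj G x y)) u v

-- Each unordered pair of distinct vertices is listed once, smaller end first.
unorderedPairs : (n : ℕ) → List (Fin n × Fin n)
unorderedPairs n =
  filter (uncurry _<?_) (cartesianProduct (allFin n) (allFin n))

edgeCount : ∀ {n} → Graph n → ℕ
edgeCount {n} G = length (filterᵇ (uncurry (adj G)) (unorderedPairs n))

differenceCount : ∀ {n} → Graph n → Graph n → ℕ
differenceCount {n} G H =
  length (filterᵇ (uncurry λ u v → adj G u v xor adj H u v) (unorderedPairs n))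

dist : ∀ {n} (m : ℕ) .{{_ : ℕ.NonZero m}} → Graph n → Graph n → ℚ
dist m G H = + differenceCount G H / m

-- dist(G, P) is a minimum over finitely many graphs, so dist(G, P) ≤ ε says
-- that some member of P is within ε.
Close : ∀ {n} (m : ℕ) .{{_ : ℕ.NonZero m}} → Property → ℚ → Graph n → Set
Close {n} m P ε G = Σ[ H ∈ Graph n ] P H × dist m G H ≤ ε

------------------------------------------------------------------------
-- Oracles and query algorithms

-- The adjacency lists, in an arbitrary fixed order, behind a neighbor oracle.
record NeighborLists {n : ℕ} (G : Graph n) : Set where
  field
    neighbors : Fin n → List (Fin n)
    unique    : ∀ v → Unique (neighbors v)
    complete  : ∀ v w → w ∈ neighbors v ⇔ T (adj G v w)

open NeighborLists public

-- Positions count from 0; there is no answer beyond the end of the list.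
nth : ∀ {A : Set} → List A → ℕ → Maybe A
nth []       _       = nothing
nth (x ∷ _)  zero    = just x
nth (_ ∷ xs) (suc i) = nth xs i

-- The adaptive computation answering one query (u , v), for fixed coin tosses.
--
-- Besides neighbor-oracle queries it may ask whether the very pair (u , v) is
-- an edge of G.  Neighbor queries alone cannot settle this in a number of
-- queries independent of n: in a connected graph made of a path and a dense
-- random graph on about √n vertices, with m = Θ(n), too few queries leave a
-- constant fraction of the m potential edges undetermined.  So without this
-- look-up no bound depending only on the error parameters is possible.
data Computation (n : ℕ) : Set where
  output   : Bool → Computation n
  degree   : Fin n → (ℕ → Computation n) → Computation n
  neighbor : Fin n → ℕ → (Maybe (Fin n) → Computation n) → Computation n
  present  : (Bool → Computation n) → Computation n

module _ {n : ℕ} {G : Graph n} (L : NeighborLists G) (u v : Fin n) where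

  run : Computation n → Bool
  run (output b)       = b
  run (degree w k)     = run (k (length (neighbors L w)))
  run (neighbor w i k) = run (k (nth (neighbors L w) i))
  run (present k)      = run (k (adj G u v))

  -- Every query is charged, including the look-up of (u , v).
  cost : Computation n → ℕ
  cost (output b)       = 0
  cost (degree w k)     = suc (cost (k (length (neighbors L w))))
  cost (neighbor w i k) = suc (cost (k (nth (neighbors L w) i)))
  cost (present k)      = suc (cost (k (adj G u v)))

-- The coin tosses are one uniformly random seed from a finite set.  The same
-- seed serves all queries, and nothing else is shared between them.
record Algorithm : Set where
  field
    seeds   : (n m : ℕ) → ℕ
    seeds≢0 : ∀ n m → ℕ.NonZero (seeds n m)
    answer  : ∀ n m → Fin (seeds n m) → (u v : Fin n) → Computation n

open Algorithm public

-- "With probability at least p": some event contained in A has probability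
-- at least p.  This avoids assuming that A is decidable.
ProbAtLeast : (N : ℕ) .{{_ : ℕ.NonZero N}} → ℚ → (Fin N → Set) → Set
ProbAtLeast N p A =
  Σ[ S ∈ Subset N ] (∀ s → s ∈ₛ S → A s) × p ≤ + ∣ S ∣ / N

------------------------------------------------------------------------
-- Local reconstructors

-- The constant c is the one implicit in m = Ω(n).
record Input (c : ℚ) (P : Property) (ε₁ : ℚ) : Set where
  field
    n m      : ℕ
    {{m≢0}}  : ℕ.NonZero m
    m=Ω[n]   : c * fromℕ n ≤ fromℕ m
    G        : Graph n
    edges≤m  : edgeCount G ℕ.≤ m
    close    : Close m P ε₁ G
    lists    : NeighborLists G

module _ (R : Algorithm) {c : ℚ} {P : Property} {ε₁ : ℚ} (I : Input c P ε₁) where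
  open Input I

  Seed : Set
  Seed = Fin (seeds R n m)

  reply : Seed → Fin n → Fin n → Bool
  reply s u v = run lists u v (answer R n m s u v)

  queries : Seed → Fin n → Fin n → ℕ
  queries s u v = cost lists u v (answer R n m s u v)

  IsEdgeOracleFor : Seed → Graph n → Set
  IsEdgeOracleFor s H = ∀ u v → reply s u v ≡ adj H u v

  QueriesAtMost : ℚ → Set
  QueriesAtMost q = ∀ s u v → fromℕ (queries s u v) ≤ q

  Reconstructs : Seed → ℚ → Set
  Reconstructs s ε₂ =
    Σ[ H ∈ Graph n ] P H × dist m G H ≤ ε₂ × IsEdgeOracleFor s H

record IsLocalReconstructor
  (c : ℚ) (P : Property) (ε₁ ε₂ δ : ℚ) (R : Algorithm) : Set where
  field
    queries-o[m] : ∀ η → 0ℚ < η →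
      Σ[ M ∈ ℕ ] ((I : Input c P ε₁) → M ℕ.≤ Input.m I →
                  QueriesAtMost R I (η * fromℕ (Input.m I)))
    correct : (I : Input c P ε₁) →
      ProbAtLeast (seeds R (Input.n I) (Input.m I))
                  {{seeds≢0 R (Input.n I) (Input.m I)}}
                  (1ℚ - δ)
                  (λ s → Reconstructs R I s ε₂)

-- The query complexity of R is at most q.
QueryComplexity≤ : (c : ℚ) (P : Property) (ε₁ : ℚ) → Algorithm → ℚ → Set
QueryComplexity≤ c P ε₁ R q = (I : Input c P ε₁) → QueriesAtMost R I q

module Submission where

-- Join a fixed vertex (the center, vertex 0) to some vertices of G, so that every component gets joined.
-- For a query {0 , v} search the component of v, starting at v, with a budget of F queries.
-- Every possible query is a "slot": one for the degree of a vertex, one for each of its neighbors.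
-- A random order of all slots is shared by all queries, and v is joined to the center iff the center was
-- not found and the earliest slot among those of the found vertices belongs to v.
--
-- The owner of the earliest slot of a component without the center is always joined, so the result is
-- connected.  If the search exhausts the component, only that owner is joined; there are at most as many
-- such components as edge differences between G and any connected graph.  Otherwise at least F slots are
-- known, so v is joined with probability at most (deg v + 1) / F; summed over v this gives on average at
-- most (n + 2m) / F superfluous edges, and Markov's inequality gives the theorem for F ≈ (2 + 1/c) / (δαε).

open import Defs
import Data.Fin.Base as Fin
import Data.Fin.Properties as Fin
import Data.Integer.Base as ℤ
import Data.Integer.Properties as ℤ
import Data.List.Relation.Unary.All as All
import Data.List.Relation.Unary.AllPairs.Properties as AllPairs
import Data.Nat.DivMod as ℕ
import Data.Nat.Properties as ℕ
import Data.Rational.Unnormalised.Base as ℚᵘ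
import Data.Rational.Unnormalised.Properties as ℚᵘ
open import Data.Bool.Base using (Bool; true; false; T; _∧_; _∨_; _xor_; not; if_then_else_)
open import Data.Bool.Properties using (T?; T-∧)
open import Data.Empty using (⊥-elim)
open import Data.Fin.Base using (Fin; zero; suc)
open import Data.Fin.Subset using (Subset; ∣_∣; inside) renaming (_∈_ to _∈ₛ_; ⊥ to ∅)
open import Data.Fin.Subset.Properties using (∉⊥)
open import Data.List.Base using (List; []; _∷_; _++_; map; length; lookup; upTo; allFin; filter; filterᵇ; cartesianProduct; concatMap)
open import Data.List.Membership.Propositional using (_∈_; _∉_)
open import Data.List.Membership.Propositional.Properties using (∈-map⁺; ∈-map⁻; ∈-++⁺ˡ; ∈-++⁺ʳ; ∈-++⁻; ∈-filter⁺; ∈-filter⁻; ∈-cartesianProduct⁺; ∈-allFin; ∈-upTo⁺; ∈-upTo⁻; ∈-lookup)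
open import Data.List.Properties using (length-map; length-++; length-upTo; length-tabulate)
open import Data.List.Relation.Binary.Subset.Propositional using (_⊆_)
open import Data.List.Relation.Unary.All using (All; []; _∷_)
open import Data.List.Relation.Unary.All.Properties using (map⁺; concat⁺; all-filter; ¬Any⇒All¬)
open import Data.List.Relation.Unary.AllPairs using (AllPairs; []; _∷_)
open import Data.List.Relation.Unary.Any using (here; there)
open import Data.List.Relation.Unary.Unique.Propositional using (Unique)
open import Data.List.Relation.Unary.Unique.Propositional.Properties using (allFin⁺; upTo⁺; filter⁺)
open import Data.Maybe.Base using (Maybe; nothing; just)
open import Data.Nat.Base as ℕ using (ℕ; zero; suc; z≤n; s≤s; s≤s⁻¹)
open import Data.Product.Base using (Σ-syntax; ∃-syntax; _×_; _,_; proj₁; proj₂; map₂; uncurry)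
open import Data.Sum.Base using (_⊎_; inj₁; inj₂)
open import Data.Unit.Base using (tt)
open import Data.Vec.Base using ([]; _∷_; tabulate)
open import Data.Vec.Properties using ([]=⇒lookup; lookup∘tabulate)
open import Function.Base using (_∘_)
open import Function.Bundles using (Equivalence)
open import Relation.Binary.Definitions using (tri<; tri≈; tri>)
open import Relation.Binary.PropositionalEquality
open import Relation.Nullary using (¬_; Dec; yes; no; does; contradiction; ¬?)
open import Relation.Nullary.Decidable using (dec-true)
open import Relation.Unary using (Decidable)

-- A random order of the vertices instead of the slots would not do: a search that enters a dense
-- cluster may spend F queries on about √F vertices, and every pendant vertex hanging on the cluster
-- would then be elected with probability about 1/√F. Each query made is itself a slot of a found
-- vertex, so F queries always reveal F slots, while the slots owned by all vertices together number
-- at most n + 2m. Replies must agree without shared memory. The search is deterministic and never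
-- consults the random order, so what a vertex sees depends only on `G` and its neighbor lists.
-- Hence the probability of an election is a count for one fixed set of slots, although vertices of
-- one component may see different sets and elect several owners. Several owners cost edges, but
-- never connectivity. The seed set may depend on n and m but not on `G`. Therefore the order ranges
-- over all potential slots `(w , i)` with i below F, and those beyond the degree of w are passed
-- over.

module _ where
  open import Data.Nat.Base using (_+_; _*_; _≤_; _<_; _≤ᵇ_; _⊓_; _!)
  open import Data.Nat.Properties
  open import Algebra.Properties.CommutativeSemigroup +-commutativeSemigroup using (interchange; x∙yz≈y∙xz)
  open import Relation.Binary.Construct.Closure.ReflexiveTransitive as Star using (Star; ε; _◅_; _◅◅_; reverse)

  private variable
    A B : Set
    n   : ℕ

  -- Finite sums over lists

  ∑ : List A → (A → ℕ) → ℕ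
  ∑ []       f = 0
  ∑ (x ∷ xs) f = f x + ∑ xs f

  -- Probabilities are kept as sums of such indicators over all orders, multiplied out by the number
  -- of orders; rationals enter only with Markov's inequality.
  ⟦_⟧ : Bool → ℕ
  ⟦ true  ⟧ = 1
  ⟦ false ⟧ = 0

  ∑-cong : ∀ (xs : List A) {f g} → (∀ x → f x ≡ g x) → ∑ xs f ≡ ∑ xs g
  ∑-cong []       f≗g = refl
  ∑-cong (x ∷ xs) f≗g = cong₂ _+_ (f≗g x) (∑-cong xs f≗g)

  ∑-cong-All : ∀ {xs : List A} {f g} → All (λ x → f x ≡ g x) xs → ∑ xs f ≡ ∑ xs g
  ∑-cong-All []         = refl
  ∑-cong-All (eq ∷ eqs) = cong₂ _+_ eq (∑-cong-All eqs)

  ∑-mono : ∀ (xs : List A) {f g} → (∀ x → f x ≤ g x) → ∑ xs f ≤ ∑ xs g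
  ∑-mono []       f≤g = z≤n
  ∑-mono (x ∷ xs) f≤g = +-mono-≤ (f≤g x) (∑-mono xs f≤g)

  ∑-zero : ∀ (xs : List A) → ∑ xs (λ _ → 0) ≡ 0
  ∑-zero []       = refl
  ∑-zero (x ∷ xs) = ∑-zero xs

  ∑-one : ∀ (xs : List A) → ∑ xs (λ _ → 1) ≡ length xs
  ∑-one []       = refl
  ∑-one (x ∷ xs) = cong suc (∑-one xs)

  ∑-+ : ∀ (xs : List A) {f g} → ∑ xs (λ x → f x + g x) ≡ ∑ xs f + ∑ xs g
  ∑-+ []               = refl
  ∑-+ (x ∷ xs) {f} {g} rewrite ∑-+ xs {f} {g} = interchange (f x) (g x) (∑ xs f) (∑ xs g)

  ∑-*ʳ : ∀ (xs : List A) {f} c → ∑ xs (λ x → f x * c) ≡ ∑ xs f * c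
  ∑-*ʳ []           c = refl
  ∑-*ʳ (x ∷ xs) {f} c rewrite ∑-*ʳ xs {f} c = sym (*-distribʳ-+ c (f x) (∑ xs f))

  ∑-swap : ∀ (xs : List A) (ys : List B) {f : A → B → ℕ} →
           ∑ xs (λ x → ∑ ys (f x)) ≡ ∑ ys (λ y → ∑ xs (λ x → f x y))
  ∑-swap []       ys     = sym (∑-zero ys)
  ∑-swap (x ∷ xs) ys {f} = trans (cong (∑ ys (f x) +_) (∑-swap xs ys)) (sym (∑-+ ys))

  ∑-++ : ∀ (xs ys : List A) {f} → ∑ (xs ++ ys) f ≡ ∑ xs f + ∑ ys f
  ∑-++ []       ys     = refl
  ∑-++ (x ∷ xs) ys {f} = trans (cong (f x +_) (∑-++ xs ys)) (sym (+-assoc (f x) _ _))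

  ∑-map : ∀ (h : B → A) (xs : List B) {f} → ∑ (map h xs) f ≡ ∑ xs (f ∘ h)
  ∑-map h []           = refl
  ∑-map h (x ∷ xs) {f} = cong (f (h x) +_) (∑-map h xs)

  ∑-concatMap : ∀ (h : B → List A) (xs : List B) {f} →
                ∑ (concatMap h xs) f ≡ ∑ xs (λ x → ∑ (h x) f)
  ∑-concatMap h []           = refl
  ∑-concatMap h (x ∷ xs) {f} = trans (∑-++ (h x) (concatMap h xs)) (cong (∑ (h x) f +_) (∑-concatMap h xs))

  ∑-× : ∀ (xs : List A) (ys : List B) {f : A × B → ℕ} →
        ∑ (cartesianProduct xs ys) f ≡ ∑ xs (λ x → ∑ ys (λ y → f (x , y)))
  ∑-× []       ys     = refl
  ∑-× (x ∷ xs) ys {f} = trans (∑-++ (map (x ,_) ys) (cartesianProduct xs ys))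
                              (cong₂ _+_ (∑-map (x ,_) ys) (∑-× xs ys))

  ∑-filter : ∀ {P : A → Set} (P? : Decidable P) (xs : List A) {f : A → ℕ} →
             ∑ (filter P? xs) f ≡ ∑ xs (λ x → ⟦ does (P? x) ⟧ * f x)
  ∑-filter P? []       = refl
  ∑-filter P? (x ∷ xs) {f} with does (P? x)
  ... | true  = cong₂ _+_ (sym (+-identityʳ (f x))) (∑-filter P? xs)
  ... | false = ∑-filter P? xs

  length-filterᵇ : ∀ (p : A → Bool) (xs : List A) → length (filterᵇ p xs) ≡ ∑ xs (λ x → ⟦ p x ⟧)
  length-filterᵇ p []       = refl
  length-filterᵇ p (x ∷ xs) with p x
  ... | true  = cong suc (length-filterᵇ p xs)
  ... | false = length-filterᵇ p xs

  ∑-complement : ∀ (xs : List A) (p : A → Bool) →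
                 ∑ xs (λ x → ⟦ p x ⟧) + ∑ xs (λ x → ⟦ not (p x) ⟧) ≡ length xs
  ∑-complement xs p = trans (sym (∑-+ xs)) (trans (∑-cong xs λ x → one (p x)) (∑-one xs))
    where
    one : ∀ b → ⟦ b ⟧ + ⟦ not b ⟧ ≡ 1
    one true  = refl
    one false = refl

  delete : ∀ {x : A} {xs} → x ∈ xs → List A
  delete {xs = _ ∷ xs} (here _)  = xs
  delete {xs = y ∷ xs} (there i) = y ∷ delete i

  ∑-delete : ∀ {x : A} {xs} (i : x ∈ xs) {f} → ∑ xs f ≡ f x + ∑ (delete i) f
  ∑-delete (here refl)                    = refl
  ∑-delete {x = x} {y ∷ xs} (there i) {f} = begin
    f y + ∑ xs f                 ≡⟨ cong (f y +_) (∑-delete i) ⟩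
    f y + (f x + ∑ (delete i) f) ≡⟨ x∙yz≈y∙xz (f y) (f x) _ ⟩
    f x + (f y + ∑ (delete i) f) ∎
    where open ≡-Reasoning

  ∈-delete : ∀ {x y : A} {xs} (i : x ∈ xs) → x ≢ y → y ∈ xs → y ∈ delete i
  ∈-delete (here refl) x≢y (here refl) = contradiction refl x≢y
  ∈-delete (here refl) x≢y (there j)   = j
  ∈-delete (there i)   x≢y (here refl) = here refl
  ∈-delete (there i)   x≢y (there j)   = there (∈-delete i x≢y j)

  -- Each entry of `xs` uses up one occurrence in `ys`; by uniqueness the later entries differ from
  -- it, so their occurrences survive the deletion.
  ∑-⊆ : ∀ {xs ys : List A} {f} → Unique xs → xs ⊆ ys → ∑ xs f ≤ ∑ ys f
  ∑-⊆ {xs = []}              _            _     = z≤n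
  ∑-⊆ {xs = x ∷ xs} {ys} {f} (x∉xs ∷ xs!) xs⊆ys = begin
    f x + ∑ xs f              ≤⟨ +-monoʳ-≤ (f x) (∑-⊆ xs! λ y∈xs → ∈-delete x∈ys (All.lookup x∉xs y∈xs) (xs⊆ys (there y∈xs))) ⟩
    f x + ∑ (delete x∈ys) f   ≡⟨ ∑-delete x∈ys ⟨
    ∑ ys f                    ∎
    where
    open ≤-Reasoning
    x∈ys = xs⊆ys (here refl)

  -- Random orders of a list

  picks : List A → List (A × List A)
  picks []       = []
  picks (x ∷ xs) = (x , xs) ∷ map (map₂ (x ∷_)) (picks xs)

  ∑-picks : ∀ (xs : List A) {f} → ∑ (picks xs) (f ∘ proj₁) ≡ ∑ xs f
  ∑-picks []           = refl
  ∑-picks (x ∷ xs) {f} = cong (f x +_) (trans (∑-map (map₂ (x ∷_)) (picks xs)) (∑-picks xs))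

  -- Stands for "`xs` is a permutation of `x ∷ r`" through two consequences: equal sums for the
  -- counting, and inclusion to show that every order contains all slots.
  IsPick : List A → A × List A → Set
  IsPick xs (x , r) = (∀ f → ∑ xs f ≡ f x + ∑ r f) × xs ⊆ x ∷ r

  picks-IsPick : (xs : List A) → All (IsPick xs) (picks xs)
  picks-IsPick []       = []
  picks-IsPick (x ∷ xs) = ((λ f → refl) , λ i → i) ∷ map⁺ (All.map extend (picks-IsPick xs))
    where
    extend : ∀ {p} → IsPick xs p → IsPick (x ∷ xs) (map₂ (x ∷_) p)
    extend {y , r} (sums , covers) = sums′ , covers′
      where
      sums′ : ∀ f → f x + ∑ xs f ≡ f y + (f x + ∑ r f)
      sums′ f rewrite sums f = x∙yz≈y∙xz (f x) (f y) (∑ r f)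
      covers′ : x ∷ xs ⊆ y ∷ x ∷ r
      covers′ (here refl) = there (here refl)
      covers′ (there i) with covers i
      ... | here refl = here refl
      ... | there j   = there (there j)

  -- The first argument is the length of the list.
  orders : ℕ → List A → List (List A)
  orders zero    xs = [] ∷ []
  orders (suc k) xs = concatMap (λ (x , r) → map (x ∷_) (orders k r)) (picks xs)

  -- In the uses `a` is a part of `b`, and this is the event that the earliest element of `b` lies
  -- in `a`.
  first : (a b : A → Bool) → List A → Bool
  first a b []       = false
  first a b (x ∷ xs) = if b x then a x else first a b xs

  private
    length-pick : ∀ {k} {xs : List A} {x r} → length xs ≡ suc k → IsPick xs (x , r) → length r ≡ k
    length-pick {k = k} {xs} {x} {r} eq (sums , _) = suc-injective (begin
      suc (length r)         ≡⟨ cong suc (∑-one r) ⟨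
      suc (∑ r (λ _ → 1))    ≡⟨ sums (λ _ → 1) ⟨
      ∑ xs (λ _ → 1)         ≡⟨ ∑-one xs ⟩
      length xs              ≡⟨ eq ⟩
      suc k                  ∎)
      where open ≡-Reasoning

    ∑-orders : ∀ k (xs : List A) {f} →
               ∑ (orders (suc k) xs) f ≡ ∑ (picks xs) (λ (x , r) → ∑ (orders k r) (λ o → f (x ∷ o)))
    ∑-orders k xs = trans (∑-concatMap (λ (x , r) → map (x ∷_) (orders k r)) (picks xs))
                          (∑-cong (picks xs) λ (x , r) → ∑-map (x ∷_) (orders k r))

  length-orders : ∀ k (xs : List A) → length xs ≡ k → length (orders k xs) ≡ k !
  length-orders k xs eq = trans (sym (∑-one (orders k xs))) (go k xs eq)
    where
    go : ∀ k (xs : List A) → length xs ≡ k → ∑ (orders k xs) (λ _ → 1) ≡ k !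
    go zero    xs eq = refl
    go (suc k) xs eq = begin
      ∑ (orders (suc k) xs) (λ _ → 1)                     ≡⟨ ∑-orders k xs ⟩
      ∑ (picks xs) (λ (x , r) → ∑ (orders k r) (λ _ → 1)) ≡⟨ ∑-cong-All (All.map (λ {p} pick → trans (go k (proj₂ p) (length-pick eq pick)) (sym (*-identityˡ (k !)))) (picks-IsPick xs)) ⟩
      ∑ (picks xs) (λ _ → 1 * k !)                        ≡⟨ ∑-*ʳ (picks xs) (k !) ⟩
      ∑ (picks xs) (λ _ → 1) * k !                        ≡⟨ cong (_* k !) (trans (∑-picks xs) (trans (∑-one xs) eq)) ⟩
      suc k * k !                                         ∎
      where open ≡-Reasoning

  orders-⊇ : ∀ k (xs : List A) → length xs ≡ k → All (xs ⊆_) (orders k xs)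
  orders-⊇ zero    []       eq = (λ ()) ∷ []
  orders-⊇ (suc k) xs       eq = concat⁺ (map⁺ (All.map extend (picks-IsPick xs)))
    where
    extend : ∀ {p} → IsPick xs p → All (xs ⊆_) (map (proj₁ p ∷_) (orders k (proj₂ p)))
    extend {x , r} pick@(_ , covers) = map⁺ (All.map {P = r ⊆_} {Q = λ o → xs ⊆ x ∷ o} cons (orders-⊇ k r (length-pick eq pick)))
      where
      cons : ∀ {o} → r ⊆ o → xs ⊆ x ∷ o
      cons r⊆o i with covers i
      ... | here eq = here eq
      ... | there j = there (r⊆o j)

  -- In a random order the first element satisfying b is equally likely to be any of them.
  orders-first : ∀ {a b : A → Bool} → (∀ x → b x ≡ false → a x ≡ false) →
                 ∀ k xs → length xs ≡ k →
                 ∑ (orders k xs) (λ o → ⟦ first a b o ⟧) * ∑ xs (λ x → ⟦ b x ⟧) ≡ ∑ xs (λ x → ⟦ a x ⟧) * k !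
  orders-first         a⇒b zero    []   eq = refl
  orders-first {A = A} {a = a} {b} a⇒b (suc k) xs eq = begin
    ∑ (orders (suc k) xs) (λ o → ⟦ first a b o ⟧) * β                                ≡⟨ cong (_* β) (∑-orders k xs) ⟩
    ∑ (picks xs) (λ (x , r) → ∑ (orders k r) (λ o → ⟦ first a b (x ∷ o) ⟧)) * β      ≡⟨ ∑-*ʳ (picks xs) β ⟨
    ∑ (picks xs) (λ (x , r) → ∑ (orders k r) (λ o → ⟦ first a b (x ∷ o) ⟧) * β)      ≡⟨ ∑-cong-All (All.map term (picks-IsPick xs)) ⟩
    ∑ (picks xs) (λ (x , _) → (⟦ a x ⟧ * β + ⟦ not (b x) ⟧ * α) * k !)               ≡⟨ ∑-picks xs ⟩
    ∑ xs (λ x → (⟦ a x ⟧ * β + ⟦ not (b x) ⟧ * α) * k !)                             ≡⟨ ∑-*ʳ xs (k !) ⟩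
    ∑ xs (λ x → ⟦ a x ⟧ * β + ⟦ not (b x) ⟧ * α) * k !                               ≡⟨ cong (_* k !) (∑-+ xs) ⟩
    (∑ xs (λ x → ⟦ a x ⟧ * β) + ∑ xs (λ x → ⟦ not (b x) ⟧ * α)) * k !                ≡⟨ cong (_* k !) (cong₂ _+_ (∑-*ʳ xs β) (∑-*ʳ xs α)) ⟩
    (α * β + γ * α) * k !                                                            ≡⟨ cong (λ z → (z + γ * α) * k !) (*-comm α β) ⟩
    (β * α + γ * α) * k !                                                            ≡⟨ cong (_* k !) (*-distribʳ-+ α β γ) ⟨
    (β + γ) * α * k !                                                                ≡⟨ cong (λ z → z * α * k !) β+γ≡1+k ⟩
    suc k * α * k !                                                                  ≡⟨ cong (_* k !) (*-comm (suc k) α) ⟩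
    α * suc k * k !                                                                  ≡⟨ *-assoc α (suc k) (k !) ⟩
    α * (suc k) !                                                                    ∎
    where
    open ≡-Reasoning
    α = ∑ xs (λ x → ⟦ a x ⟧)
    β = ∑ xs (λ x → ⟦ b x ⟧)
    γ = ∑ xs (λ x → ⟦ not (b x) ⟧)

    β+γ≡1+k : β + γ ≡ suc k
    β+γ≡1+k = trans (∑-complement xs b) eq

    term : ∀ {p} → IsPick xs p →
           ∑ (orders k (proj₂ p)) (λ o → ⟦ first a b (proj₁ p ∷ o) ⟧) * β ≡
           (⟦ a (proj₁ p) ⟧ * β + ⟦ not (b (proj₁ p)) ⟧ * α) * k !
    -- If `b x` holds, x alone decides for all k! tails. Otherwise the tail `r` still contains all
    -- of `b`, so induction applies with the same β. Summed over x this gives (β + γ)α, and β + γ is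
    -- the length of the list.
    term {x , r} pick@(sums , _) with b x in bx | sums (λ y → ⟦ b y ⟧)
    ... | true  | _ = begin
      ∑ (orders k r) (λ _ → ⟦ a x ⟧) * β         ≡⟨ cong (_* β) (∑-cong (orders k r) (λ _ → sym (*-identityˡ ⟦ a x ⟧))) ⟩
      ∑ (orders k r) (λ _ → 1 * ⟦ a x ⟧) * β     ≡⟨ cong (_* β) (∑-*ʳ (orders k r) ⟦ a x ⟧) ⟩
      ∑ (orders k r) (λ _ → 1) * ⟦ a x ⟧ * β     ≡⟨ cong (λ z → z * ⟦ a x ⟧ * β) (trans (∑-one (orders k r)) (length-orders k r (length-pick eq pick))) ⟩
      k ! * ⟦ a x ⟧ * β                          ≡⟨ *-assoc (k !) ⟦ a x ⟧ β ⟩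
      k ! * (⟦ a x ⟧ * β)                        ≡⟨ *-comm (k !) _ ⟩
      ⟦ a x ⟧ * β * k !                          ≡⟨ cong (_* k !) (+-identityʳ (⟦ a x ⟧ * β)) ⟨
      (⟦ a x ⟧ * β + 0) * k !                    ∎
    ... | false | β≡ = begin
      ∑ (orders k r) (λ o → ⟦ first a b o ⟧) * β ≡⟨ cong (∑ (orders k r) (λ o → ⟦ first a b o ⟧) *_) β≡ ⟩
      ∑ (orders k r) (λ o → ⟦ first a b o ⟧) * ∑ r (λ y → ⟦ b y ⟧) ≡⟨ orders-first a⇒b k r (length-pick eq pick) ⟩
      ∑ r (λ y → ⟦ a y ⟧) * k !                  ≡⟨ cong (_* k !) (trans (sums (λ y → ⟦ a y ⟧)) (cong (λ c → ⟦ c ⟧ + ∑ r (λ y → ⟦ a y ⟧)) ax)) ⟨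
      α * k !                                    ≡⟨ cong (_* k !) (+-identityʳ α) ⟨
      (α + 0) * k !                              ≡⟨ cong (λ c → (⟦ c ⟧ * β + (α + 0)) * k !) ax ⟨
      (⟦ a x ⟧ * β + (α + 0)) * k !              ∎
      where ax = a⇒b x bx

  -- Labelling connected components

  _∼[_]_ : Fin n → Graph n → Fin n → Set
  u ∼[ G ] v = Star (λ x y → T (adj G x y)) u v

  ∼-sym : (G : Graph n) → ∀ {u v} → u ∼[ G ] v → v ∼[ G ] u
  ∼-sym G = reverse λ {x} {y} → subst T (symmetric G x y)

  -- A function f labels the classes of a partition; adding the edge (a , b) unites two of them.
  merge : Fin n × Fin n → (Fin n → Fin n) → (Fin n → Fin n)
  merge (a , b) f x = if does (f x Fin.≟ f a) then f b else f x

  merges : List (Fin n × Fin n) → (Fin n → Fin n) → (Fin n → Fin n)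
  merges []       f = f
  merges (e ∷ es) f = merges es (merge e f)

  merge-cong : ∀ (e : Fin n × Fin n) f {x y} → f x ≡ f y → merge e f x ≡ merge e f y
  merge-cong e f eq rewrite eq = refl

  merges-cong : ∀ (es : List (Fin n × Fin n)) f {x y} → f x ≡ f y → merges es f x ≡ merges es f y
  merges-cong []       f eq = eq
  merges-cong (e ∷ es) f eq = merges-cong es (merge e f) (merge-cong e f eq)

  merge-edge : ∀ (a b : Fin n) f → merge (a , b) f a ≡ merge (a , b) f b
  merge-edge a b f with f a Fin.≟ f a | f b Fin.≟ f a
  ... | yes _ | yes _  = refl
  ... | yes _ | no  _  = refl
  ... | no ≢  | _      = contradiction refl ≢

  merges-edge : ∀ (es : List (Fin n × Fin n)) f {a b} → (a , b) ∈ es → merges es f a ≡ merges es f b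
  merges-edge (e ∷ es) f {a} {b} (here refl) = merges-cong es (merge e f) (merge-edge a b f)
  merges-edge (e ∷ es) f         (there i)   = merges-edge es (merge e f) i

  module _ (G : Graph n) where

    Sound : (Fin n → Fin n) → Set
    Sound f = ∀ {x y} → f x ≡ f y → x ∼[ G ] y

    merge-sound : ∀ {a b} → T (adj G a b) → ∀ f → Sound f → Sound (merge (a , b) f)
    merge-sound {a} {b} ab f sound {x} {y} eq with f x Fin.≟ f a | f y Fin.≟ f a
    ... | yes p | yes q = sound (trans p (sym q))
    ... | yes p | no  _ = sound p ◅◅ (ab ◅ sound eq)
    ... | no  _ | yes q = ∼-sym G (sound q ◅◅ (ab ◅ sound (sym eq)))
    ... | no  _ | no  _ = sound eq

    merges-sound : ∀ {es} → All (T ∘ uncurry (adj G)) es → ∀ f → Sound f → Sound (merges es f)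
    merges-sound []       f sound = sound
    merges-sound (e ∷ es) f sound = merges-sound es _ (merge-sound e f sound)

  ∈-unorderedPairs : ∀ {u v : Fin n} → u Fin.< v → (u , v) ∈ unorderedPairs n
  ∈-unorderedPairs {u = u} {v} = ∈-filter⁺ (uncurry Fin._<?_) (∈-cartesianProduct⁺ (∈-allFin u) (∈-allFin v))

  merges-unordered : ∀ (p : Fin n → Fin n → Bool) f → (∀ u v → p u v ≡ p v u) →
                     let g = merges (filterᵇ (uncurry p) (unorderedPairs n)) f in
                     ∀ {u v} → T (p u v) → g u ≡ g v
  merges-unordered p f p-sym {u} {v} puv with Fin.<-cmp u v
  ... | tri< u<v _ _  = merges-edge _ f (∈-filter⁺ (T? ∘ uncurry p) (∈-unorderedPairs u<v) puv)
  ... | tri≈ _ refl _ = refl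
  ... | tri> _ _ v<u  = sym (merges-edge _ f (∈-filter⁺ (T? ∘ uncurry p) (∈-unorderedPairs v<u) (subst T (p-sym u v) puv)))

  -- A computable label of the connected component: it makes lying in one component decidable, so
  -- that the slots of a whole component form a Boolean predicate.
  component : Graph n → Fin n → Fin n
  component {n} G = merges (filterᵇ (uncurry (adj G)) (unorderedPairs n)) (λ v → v)

  component-sound : (G : Graph n) → ∀ {u v} → component G u ≡ component G v → u ∼[ G ] v
  component-sound {n} G = merges-sound G (all-filter (T? ∘ uncurry (adj G)) (unorderedPairs n)) (λ v → v) λ { refl → ε }

  component-adj : (G : Graph n) → ∀ {u v} → T (adj G u v) → component G u ≡ component G v
  component-adj G = merges-unordered (adj G) (λ v → v) (symmetric G)

  component-complete : (G : Graph n) → ∀ {u v} → u ∼[ G ] v → component G u ≡ component G v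
  component-complete G ε        = refl
  component-complete G (e ◅ es) = trans (component-adj G e) (component-complete G es)

  -- Counting components

  Separated : (Fin n → Fin n) → List (Fin n) → Set
  Separated f = AllPairs λ x y → f x ≢ f y

  -- Dropping the vertex labelled like a, if any, keeps a list separated by merge (a , b).
  merge-separated : ∀ (e : Fin n × Fin n) f {xs} → Separated f xs →
                    Σ[ ys ∈ List (Fin n) ] Separated (merge e f) ys × length xs ≤ suc (length ys)
  merge-separated {n} e@(a , b) f {xs} sep =
    others xs , separated (all-filter other? xs) (AllPairs.filter⁺ other? sep) , bound sep
    where
    other? : ∀ x → Dec (¬ f x ≡ f a)
    other? x = ¬? (f x Fin.≟ f a)

    others : List (Fin n) → List (Fin n)
    others = filter other?

    unmerged : ∀ {x} → f x ≢ f a → merge e f x ≡ f x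
    unmerged {x} ≢ with f x Fin.≟ f a
    ... | yes eq = contradiction eq ≢
    ... | no  _  = refl

    separated : ∀ {ys} → All (λ y → f y ≢ f a) ys → Separated f ys → Separated (merge e f) ys
    separated []       []         = []
    separated (p ∷ ps) (y# ∷ ys#) =
      All.zipWith (λ (q , ≢) eq → ≢ (trans (sym (unmerged p)) (trans eq (unmerged q)))) (ps , y#) ∷ separated ps ys#

    all-others : ∀ {ys} → All (λ y → f a ≢ f y) ys → length ys ≤ length (others ys)
    all-others []                = z≤n
    all-others {y ∷ ys} (≢ ∷ ≢s) with f y Fin.≟ f a
    ... | yes eq = contradiction (sym eq) ≢
    ... | no  _  = s≤s (all-others ≢s)

    bound : ∀ {xs} → Separated f xs → length xs ≤ suc (length (others xs))
    bound []                  = z≤n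
    bound {x ∷ xs} (x# ∷ xs#) with f x Fin.≟ f a
    ... | yes eq = s≤s (all-others (All.map (λ ≢ eq′ → ≢ (trans eq eq′)) x#))
    ... | no  _  = s≤s (bound xs#)

  -- Each merge costs at most one class, and a single class remains at the end.
  merges-separated : ∀ (es : List (Fin n × Fin n)) f {xs} → Separated f xs →
                     (∀ u v → merges es f u ≡ merges es f v) → length xs ≤ suc (length es)
  merges-separated [] f {[]}         sep const = z≤n
  merges-separated [] f {_ ∷ []}     sep const = s≤s z≤n
  merges-separated [] f {x ∷ y ∷ xs} ((≢ ∷ _) ∷ _) const = contradiction (const x y) ≢
  merges-separated (e ∷ es) f sep const with merge-separated e f sep
  ... | ys , sep′ , le = ≤-trans le (s≤s (merges-separated es (merge e f) sep′ const))

  -- Merge the component labels of `G` along all differing pairs. An edge of `H` either lies in `G`,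
  -- so its ends had equal labels from the start, or is a differing pair, so its ends are merged.
  -- Since `H` is connected, the final labelling is constant.
  components≤differences : ∀ (G H : Graph n) → Connected H → ∀ {xs} →
                           Separated (component G) xs → length xs ≤ suc (differenceCount G H)
  components≤differences G H conn sep =
    merges-separated differing (component G) sep λ u v → constant (conn u v)
    where
    differ : Fin _ → Fin _ → Bool
    differ u v = adj G u v xor adj H u v

    differ-sym : ∀ u v → differ u v ≡ differ v u
    differ-sym u v = cong₂ _xor_ (symmetric G u v) (symmetric H u v)

    differing : List (Fin _ × Fin _)
    differing = filterᵇ (uncurry differ) (unorderedPairs _)

    f = merges differing (component G)

    step : ∀ {u v} → T (adj H u v) → f u ≡ f v
    step {u} {v} uv with adj G u v in eqG | adj H u v in eqH
    ... | true  | true  = merges-cong differing (component G) (component-adj G (subst T (sym eqG) tt))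
    ... | false | true  = merges-unordered differ (component G) differ-sym {u} {v} (subst T (sym (cong₂ _xor_ eqG eqH)) tt)

    constant : ∀ {u v} → u ∼[ H ] v → f u ≡ f v
    constant ε        = refl
    constant (e ◅ es) = trans (step e) (constant es)

  -- Indicators, unordered pairs and the sum of the degrees

  T-∨ˡ : ∀ {b c} → T b → T (b ∨ c)
  T-∨ˡ {true} _ = tt

  T-∨ʳ : ∀ b {c} → T c → T (b ∨ c)
  T-∨ʳ true  _ = tt
  T-∨ʳ false c = c

  ⟦⟧-≤ : ∀ {b c} → (T b → T c) → ⟦ b ⟧ ≤ ⟦ c ⟧
  ⟦⟧-≤ {false}         imp = z≤n
  ⟦⟧-≤ {true}  {true}  imp = ≤-refl
  ⟦⟧-≤ {true}  {false} imp = contradiction (imp tt) λ ()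

  ∑-atMostOne : ∀ (p : A → Bool) → (∀ {x y} → T (p x) → T (p y) → x ≡ y) →
                ∀ {xs} → Unique xs → ∑ xs (λ x → ⟦ p x ⟧) ≤ 1
  ∑-atMostOne p ! []                   = z≤n
  ∑-atMostOne p ! {x ∷ xs} (x∉ ∷ xs!) with p x in px
  ... | false = ∑-atMostOne p ! xs!
  ... | true  = s≤s (≤-reflexive (trans (∑-cong-All (All.map absent x∉)) (∑-zero xs)))
    where
    absent : ∀ {y} → x ≢ y → ⟦ p y ⟧ ≡ 0
    absent {y} x≢y with p y in py
    ... | true  = contradiction (! (subst T (sym px) tt) (subst T (sym py) tt)) x≢y
    ... | false = refl

  ∑-unorderedPairs : ∀ n {f : Fin n × Fin n → ℕ} →
                     ∑ (unorderedPairs n) f ≡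
                     ∑ (allFin n) (λ u → ∑ (allFin n) λ v → ⟦ does (u Fin.<? v) ⟧ * f (u , v))
  ∑-unorderedPairs n = trans (∑-filter (uncurry Fin._<?_) (cartesianProduct (allFin n) (allFin n)))
                               (∑-× (allFin n) (allFin n))

  module _ {G : Graph n} (L : NeighborLists G) where

    deg : Fin n → ℕ
    deg v = length (neighbors L v)

    deg≤ : ∀ v → deg v ≤ ∑ (allFin n) (λ w → ⟦ adj G v w ⟧)
    deg≤ v = begin
      deg v                                           ≡⟨ ∑-one (neighbors L v) ⟨
      ∑ (neighbors L v) (λ _ → 1)                     ≤⟨ ∑-⊆ (unique L v) (λ {w} i → ∈-filter⁺ (T? ∘ adj G v) (∈-allFin w) (Equivalence.to (complete L v w) i)) ⟩
      ∑ (filterᵇ (adj G v) (allFin n)) (λ _ → 1)      ≡⟨ ∑-one (filterᵇ (adj G v) (allFin n)) ⟩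
      length (filterᵇ (adj G v) (allFin n))           ≡⟨ length-filterᵇ (adj G v) (allFin n) ⟩
      ∑ (allFin n) (λ w → ⟦ adj G v w ⟧)              ∎
      where open ≤-Reasoning

    edgeCount-∑ : edgeCount G ≡ ∑ (allFin n) (λ u → ∑ (allFin n) λ v → ⟦ does (u Fin.<? v) ⟧ * ⟦ adj G u v ⟧)
    edgeCount-∑ = trans (length-filterᵇ (uncurry (adj G)) (unorderedPairs n)) (∑-unorderedPairs n)

    ∑-deg : ∑ (allFin n) deg ≤ edgeCount G + edgeCount G
    ∑-deg = begin
      ∑ V deg                                                                           ≤⟨ ∑-mono V deg≤ ⟩
      ∑ V (λ u → ∑ V λ v → ⟦ adj G u v ⟧)                                               ≤⟨ ∑-mono V (λ u → ∑-mono V (split u)) ⟩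
      ∑ V (λ u → ∑ V λ v → ordered u v + ordered v u)                                   ≡⟨ ∑-cong V (λ u → ∑-+ V) ⟩
      ∑ V (λ u → ∑ V (ordered u) + ∑ V λ v → ordered v u)                               ≡⟨ ∑-+ V ⟩
      ∑ V (λ u → ∑ V (ordered u)) + ∑ V (λ u → ∑ V λ v → ordered v u)                   ≡⟨ cong (∑ V (λ u → ∑ V (ordered u)) +_) (∑-swap V V) ⟩
      ∑ V (λ u → ∑ V (ordered u)) + ∑ V (λ u → ∑ V (ordered u))                         ≡⟨ cong₂ _+_ edgeCount-∑ edgeCount-∑ ⟨
      edgeCount G + edgeCount G                                                         ∎
      where
      open ≤-Reasoning
      V = allFin n

      ordered : Fin n → Fin n → ℕ
      ordered u v = ⟦ does (u Fin.<? v) ⟧ * ⟦ adj G u v ⟧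

      split : ∀ u v → ⟦ adj G u v ⟧ ≤ ordered u v + ordered v u
      split u v with Fin.<-cmp u v
      ... | tri< u<v _ _  rewrite dec-true (u Fin.<? v) u<v = m≤n⇒m≤n+o (ordered v u) (m≤m+n ⟦ adj G u v ⟧ 0)
      ... | tri≈ _ refl _ rewrite irreflexive G u = z≤n
      ... | tri> _ _ v<u  rewrite dec-true (v Fin.<? u) v<u | symmetric G u v = m≤n⇒m≤o+n (⟦ does (u Fin.<? v) ⟧ * ⟦ adj G v u ⟧) (m≤m+n ⟦ adj G v u ⟧ 0)

  -- Joining vertices to the center

  -- A predicate rather than a vertex, because `Fin n` may be empty.
  center : Fin n → Bool
  center zero    = true
  center (suc _) = false

  link : (Fin n → Bool) → Fin n → Fin n → Bool
  link s zero    zero    = false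
  link s zero    (suc v) = s (suc v)
  link s (suc u) zero    = s (suc u)
  link s (suc u) (suc v) = false

  link-sym : ∀ (s : Fin n → Bool) u v → link s u v ≡ link s v u
  link-sym s zero    zero    = refl
  link-sym s zero    (suc v) = refl
  link-sym s (suc u) zero    = refl
  link-sym s (suc u) (suc v) = refl

  link-irrefl : ∀ (s : Fin n → Bool) v → link s v v ≡ false
  link-irrefl s zero    = refl
  link-irrefl s (suc v) = refl

  center! : ∀ {u v : Fin n} → T (center u) → T (center v) → u ≡ v
  center! {u = zero} {zero} _ _ = refl

  -- The center can be added to the list and keeps it separated, which absorbs the extra one in
  -- `components≤differences`.
  separated≤differences : ∀ (G H : Graph n) → Connected H → ∀ {xs} → Separated (component G) xs →
                          All (λ x → ∀ c → T (center c) → component G c ≢ component G x) xs →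
                          length xs ≤ differenceCount G H
  separated≤differences {zero}  G H conn {[]} sep away = z≤n
  separated≤differences {suc n} G H conn      sep away =
    s≤s⁻¹ (components≤differences G H conn (All.map (λ ≢center → ≢center zero tt) away ∷ sep))

  attach : Graph n → (Fin n → Bool) → Graph n
  attach G s .adj         u v = adj G u v ∨ link s u v
  attach G s .symmetric   u v = cong₂ _∨_ (symmetric G u v) (link-sym s u v)
  attach G s .irreflexive v   = cong₂ _∨_ (irreflexive G v) (link-irrefl s v)

  star : Graph n
  star .adj         = link λ _ → true
  star .symmetric   = link-sym λ _ → true
  star .irreflexive = link-irrefl λ _ → true

  connected-via : (G : Graph (suc n)) → (∀ v → v ∼[ G ] zero) → Connected G
  connected-via G to-zero u v = to-zero u ◅◅ ∼-sym G (to-zero v)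

  star-connected : Connected (star {n})
  star-connected {suc n} = connected-via star λ where
    zero    → ε
    (suc v) → tt ◅ ε

  attach-connected : (G : Graph n) (s : Fin n → Bool) →
                     (∀ v → Σ[ w ∈ Fin n ] v ∼[ G ] w × T (center w ∨ s w)) → Connected (attach G s)
  attach-connected {suc n} G s reaches = connected-via (attach G s) to-zero
    where
    lift : ∀ {u v} → u ∼[ G ] v → u ∼[ attach G s ] v
    lift = Star.map T-∨ˡ

    to-zero : ∀ v → v ∼[ attach G s ] zero
    to-zero v with reaches v
    ... | zero  , v∼w , _  = lift v∼w
    ... | suc w , v∼w , sw = lift v∼w ◅◅ (T-∨ʳ (adj G (suc w) zero) sw ◅ ε)

  ∑-link : (s : Fin n → Bool) → ∑ (unorderedPairs n) (λ (u , v) → ⟦ link s u v ⟧) ≤ ∑ (allFin n) (λ v → ⟦ s v ⟧)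
  ∑-link {n} s = begin
    ∑ (unorderedPairs n) (λ (u , v) → ⟦ link s u v ⟧)                   ≡⟨ ∑-unorderedPairs n ⟩
    ∑ V (λ u → ∑ V λ v → ⟦ does (u Fin.<? v) ⟧ * ⟦ link s u v ⟧)        ≤⟨ ∑-mono V (λ u → ∑-mono V (bound u)) ⟩
    ∑ V (λ u → ∑ V λ v → ⟦ s v ⟧ * ⟦ center u ⟧)                        ≡⟨ ∑-cong V (λ u → trans (∑-*ʳ V ⟦ center u ⟧) (*-comm _ ⟦ center u ⟧)) ⟩
    ∑ V (λ u → ⟦ center u ⟧ * ∑ V λ v → ⟦ s v ⟧)                        ≡⟨ ∑-*ʳ V _ ⟩
    ∑ V (λ u → ⟦ center u ⟧) * ∑ V (λ v → ⟦ s v ⟧)                      ≤⟨ *-monoˡ-≤ (∑ V (λ v → ⟦ s v ⟧)) (∑-atMostOne center center! (allFin⁺ n)) ⟩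
    1 * ∑ V (λ v → ⟦ s v ⟧)                                             ≡⟨ *-identityˡ _ ⟩
    ∑ V (λ v → ⟦ s v ⟧)                                                 ∎
    where
    open ≤-Reasoning
    V = allFin n

    -- Pairs are listed smaller end first, so the center can only be the first entry of a pair.
    bound : ∀ u v → ⟦ does (u Fin.<? v) ⟧ * ⟦ link s u v ⟧ ≤ ⟦ s v ⟧ * ⟦ center u ⟧
    bound zero    zero    = z≤n
    bound zero    (suc v) = ≤-reflexive (*-comm 1 ⟦ s (suc v) ⟧)
    bound (suc u) zero    = z≤n
    bound (suc u) (suc v) = ≤-trans (≤-reflexive (*-zeroʳ ⟦ does (suc u Fin.<? suc v) ⟧)) z≤n

  -- Only an inequality, since `s` may hold at the center or at vertices already adjacent to it.
  attach-differences : (G : Graph n) (s : Fin n → Bool) →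
                       differenceCount G (attach G s) ≤ ∑ (allFin n) (λ v → ⟦ s v ⟧)
  attach-differences {n} G s = begin
    differenceCount G (attach G s)                                              ≡⟨ length-filterᵇ _ (unorderedPairs n) ⟩
    ∑ (unorderedPairs n) (λ (u , v) → ⟦ adj G u v xor (adj G u v ∨ link s u v) ⟧) ≤⟨ ∑-mono (unorderedPairs n) (λ (u , v) → new (adj G u v) (link s u v)) ⟩
    ∑ (unorderedPairs n) (λ (u , v) → ⟦ link s u v ⟧)                           ≤⟨ ∑-link s ⟩
    ∑ (allFin n) (λ v → ⟦ s v ⟧)                                                ∎
    where
    open ≤-Reasoning
    new : ∀ a l → ⟦ a xor (a ∨ l) ⟧ ≤ ⟦ l ⟧
    new true  l = z≤n
    new false l = ≤-refl

  star-differences : (G : Graph n) → differenceCount G star ≤ edgeCount G + n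
  star-differences {n} G = begin
    differenceCount G star                                                           ≡⟨ length-filterᵇ _ E ⟩
    ∑ E (λ (u , v) → ⟦ adj G u v xor link _ u v ⟧)                                   ≤⟨ ∑-mono E (λ (u , v) → either (adj G u v) (link _ u v)) ⟩
    ∑ E (λ (u , v) → ⟦ adj G u v ⟧ + ⟦ link _ u v ⟧)                                 ≡⟨ ∑-+ E ⟩
    ∑ E (λ (u , v) → ⟦ adj G u v ⟧) + ∑ E (λ (u , v) → ⟦ link _ u v ⟧)               ≤⟨ +-mono-≤ (≤-reflexive (sym (length-filterᵇ (uncurry (adj G)) E))) (∑-link {n} λ _ → true) ⟩
    edgeCount G + ∑ (allFin n) (λ _ → 1)                                             ≡⟨ cong (edgeCount G +_) (trans (∑-one (allFin n)) (length-tabulate {n = n} (λ i → i))) ⟩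
    edgeCount G + n                                                                  ∎
    where
    open ≤-Reasoning
    E = unorderedPairs n
    either : ∀ a l → ⟦ a xor l ⟧ ≤ ⟦ a ⟧ + ⟦ l ⟧
    either true  true  = z≤n
    either true  false = ≤-refl
    either false l     = ≤-refl

  -- Local exploration

  -- Slot (w , 0) stands for the degree query to w and (w , 1 + i) for the query to its i-th neighbor.
  Slot : ℕ → Set
  Slot n = Fin n × ℕ

  -- The list pairs each vertex found so far with its degree.
  slot : List (Fin n × ℕ) → Slot n → Bool
  slot []             (x , i) = false
  slot ((w , d) ∷ ws) (x , i) = if does (w Fin.≟ x) then i ≤ᵇ d else slot ws (x , i)

  found : List (Fin n × ℕ) → Fin n → Bool
  found ws x = slot ws (x , 0)

  darts : Fin n → ℕ → List (Fin n × ℕ)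
  darts x d = map (x ,_) (upTo d)

  mutual
    explore : ℕ → (ws todo : List (Fin n × ℕ)) → (List (Fin n × ℕ) → Computation n) → Computation n
    explore zero    ws todo             k = k ws
    explore (suc f) ws []               k = k ws
    explore (suc f) ws ((w , i) ∷ todo) k = neighbor w i (visit f ws todo k)

    visit : ℕ → (ws todo : List (Fin n × ℕ)) → (List (Fin n × ℕ) → Computation n) →
            Maybe (Fin n) → Computation n
    visit f ws todo k nothing  = explore f ws todo k
    visit f ws todo k (just x) = if found ws x then explore f ws todo k else enter f ws todo k x

    enter : ℕ → (ws todo : List (Fin n × ℕ)) → (List (Fin n × ℕ) → Computation n) →
            Fin n → Computation n
    -- The new vertex is dropped: without its degree it is unknown which slots it has.
    enter zero    ws todo k x = k ws
    enter (suc f) ws todo k x = degree x λ d → explore f ((x , d) ∷ ws) (darts x d ++ todo) k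

  module _ {G : Graph n} (L : NeighborLists G) (u v : Fin n) {k : List (Fin n × ℕ) → Computation n}
           (free : ∀ ws → cost L u v (k ws) ≡ 0) where

    mutual
      cost-explore : ∀ f ws todo → cost L u v (explore f ws todo k) ≤ f
      cost-explore zero    ws todo             = ≤-reflexive (free ws)
      cost-explore (suc f) ws []               = ≤-trans (≤-reflexive (free ws)) z≤n
      cost-explore (suc f) ws ((w , i) ∷ todo) = s≤s (cost-visit f ws todo (nth (neighbors L w) i))

      cost-visit : ∀ f ws todo x → cost L u v (visit f ws todo k x) ≤ f
      cost-visit f ws todo nothing  = cost-explore f ws todo
      cost-visit f ws todo (just x) with found ws x
      ... | true  = cost-explore f ws todo
      ... | false = cost-enter f ws todo x

      cost-enter : ∀ f ws todo x → cost L u v (enter f ws todo k x) ≤ f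
      cost-enter zero    ws todo x = ≤-reflexive (free ws)
      cost-enter (suc f) ws todo x = s≤s (cost-explore f _ _)

  nth-∈ : ∀ {A : Set} (xs : List A) i {x} → nth xs i ≡ just x → x ∈ xs
  nth-∈ (x ∷ xs) zero    refl = here refl
  nth-∈ (x ∷ xs) (suc i) eq   = there (nth-∈ xs i eq)

  ∈-nth : ∀ {A : Set} {xs : List A} {x} → x ∈ xs → ∃[ i ] i < length xs × nth xs i ≡ just x
  ∈-nth (here refl) = 0 , s≤s z≤n , refl
  ∈-nth (there x∈xs) with ∈-nth x∈xs
  ... | i , i< , eq = suc i , s≤s i< , eq

  -- Invariants and outcome of the exploration

  module _ {G : Graph n} (L : NeighborLists G) where

    withDegrees : List (Fin n) → List (Fin n × ℕ)
    withDegrees = map λ w → w , deg L w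

    slot-∈ : ∀ {ws x} → x ∈ ws → ∀ i → slot (withDegrees ws) (x , i) ≡ (i ≤ᵇ deg L x)
    slot-∈ {w ∷ ws} {x} x∈ws i with w Fin.≟ x | x∈ws
    ... | yes refl | _          = refl
    ... | no  w≢x  | here refl  = contradiction refl w≢x
    ... | no  _    | there x∈ws = slot-∈ x∈ws i

    slot-∉ : ∀ {ws x} → x ∉ ws → ∀ i → slot (withDegrees ws) (x , i) ≡ false
    slot-∉ {[]}         x∉ws i = refl
    slot-∉ {w ∷ ws} {x} x∉ws i with w Fin.≟ x
    ... | yes refl = contradiction (here refl) x∉ws
    ... | no  _    = slot-∉ (x∉ws ∘ there) i

    slot⇒∈ : ∀ {ws x i} → T (slot (withDegrees ws) (x , i)) → x ∈ ws × T (i ≤ᵇ deg L x)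
    slot⇒∈ {w ∷ ws} {x} t with w Fin.≟ x
    ... | yes refl = here refl , t
    ... | no  _ with slot⇒∈ {ws} t
    ...   | x∈ws , i≤d = there x∈ws , i≤d

    -- The degree of a found vertex is known, so all its slots count at once, including those of
    -- neighbor queries never made.
    slotCount : List (Fin n) → ℕ
    slotCount ws = ∑ ws λ w → suc (deg L w)

    Closed : List (Fin n) → Set
    Closed ws = ∀ {w x} → w ∈ ws → T (adj G w x) → x ∈ ws

    record Explored (F : ℕ) (v : Fin n) (ws : List (Fin n)) : Set where
      field
        distinct  : Unique ws
        source    : v ∈ ws
        reachable : ∀ {w} → w ∈ ws → v ∼[ G ] w
        outcome   : Closed ws ⊎ F ≤ slotCount ws

    -- When the queue is empty, `frontier` becomes closedness; when f is 0, `budget` becomes F ≤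
    -- `slotCount ws`. These are the two outcomes of `Explored`.
    record Exploring (F : ℕ) (v : Fin n) (f : ℕ) (ws : List (Fin n)) (todo : List (Fin n × ℕ)) : Set where
      field
        distinct  : Unique ws
        source    : v ∈ ws
        reachable : ∀ {w} → w ∈ ws → v ∼[ G ] w
        todo-∈    : ∀ {w i} → (w , i) ∈ todo → w ∈ ws
        frontier  : ∀ {w x} → w ∈ ws → T (adj G w x) →
                    x ∈ ws ⊎ ∃[ i ] (w , i) ∈ todo × nth (neighbors L w) i ≡ just x
        -- The F ∸ f queries made so far and those still to do have different slots.
        budget    : F + length todo ≤ f + slotCount ws

    -- The found list is chosen before `a`, `b` and `k`. So it depends neither on the queried pair
    -- nor on the random order, which occurs only in the continuation.
    Yields : (F : ℕ) (v : Fin n) → ((List (Fin n × ℕ) → Computation n) → Computation n) → Set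
    Yields F v c = Σ[ ws ∈ List (Fin n) ] Explored F v ws ×
                   (∀ a b k → run L a b (c k) ≡ run L a b (k (withDegrees ws)))

    module _ {F : ℕ} {v : Fin n} where

      open Exploring

      exhausted : ∀ {ws todo} → Exploring F v 0 ws todo → Explored F v ws
      exhausted e = record
        { distinct = distinct e ; source = source e ; reachable = reachable e
        ; outcome = inj₂ (≤-trans (m≤m+n F _) (budget e)) }

      finished : ∀ {f ws} → Exploring F v f ws [] → Explored F v ws
      finished {ws = ws} e = record
        { distinct = distinct e ; source = source e ; reachable = reachable e
        ; outcome = inj₁ closed }
        where
        closed : Closed ws
        closed w∈ws wx with frontier e w∈ws wx
        ... | inj₁ x∈ws = x∈ws

      skip : ∀ {f ws w i todo} → Exploring F v (suc f) ws ((w , i) ∷ todo) →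
             (∀ {x} → nth (neighbors L w) i ≡ just x → x ∈ ws) → Exploring F v f ws todo
      skip {f} {ws} {w} {i} {todo} e known = record
        { distinct = distinct e ; source = source e ; reachable = reachable e
        ; todo-∈ = λ j → todo-∈ e (there j)
        ; frontier = frontier′
        ; budget = s≤s⁻¹ (subst (_≤ suc f + slotCount ws) (+-suc F (length todo)) (budget e)) }
        where
        frontier′ : ∀ {y x} → y ∈ ws → T (adj G y x) →
                    x ∈ ws ⊎ ∃[ j ] (y , j) ∈ todo × nth (neighbors L y) j ≡ just x
        frontier′ y∈ws yx with frontier e y∈ws yx
        ... | inj₁ x∈ws                 = inj₁ x∈ws
        ... | inj₂ (j , here refl , eq) = inj₁ (known eq)
        ... | inj₂ (j , there t , eq)   = inj₂ (j , t , eq)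

      length-darts : ∀ x todo → length (darts x (deg L x) ++ todo) ≡ deg L x + length todo
      length-darts x todo = trans (length-++ (darts x (deg L x)))
        (cong (_+ length todo) (trans (length-map (x ,_) (upTo (deg L x))) (length-upTo (deg L x))))

      ∈-darts : ∀ {x y} → T (adj G x y) → ∀ todo →
                ∃[ i ] (x , i) ∈ darts x (deg L x) ++ todo × nth (neighbors L x) i ≡ just y
      ∈-darts {x} {y} xy todo with ∈-nth (Equivalence.from (complete L x y) xy)
      ... | i , i< , eq = i , ∈-++⁺ˡ (∈-map⁺ (x ,_) (∈-upTo⁺ i<)) , eq

      -- Two queries are spent, for the neighbor of w and for the degree of x, and one queue entry
      -- goes. In return x brings `deg L x` entries but one slot more than that, so the budget
      -- balances.
      extend : ∀ {f ws w i x todo} → Exploring F v (suc (suc f)) ws ((w , i) ∷ todo) →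
               nth (neighbors L w) i ≡ just x → x ∉ ws →
               Exploring F v f (x ∷ ws) (darts x (deg L x) ++ todo)
      extend {f} {ws} {w} {i} {x} {todo} e eq x∉ws = record
        { distinct = ¬Any⇒All¬ ws x∉ws ∷ distinct e
        ; source = there (source e)
        ; reachable = reachable′
        ; todo-∈ = todo-∈′
        ; frontier = frontier′
        ; budget = begin
            F + length (darts x (deg L x) ++ todo) ≡⟨ cong (F +_) (length-darts x todo) ⟩
            F + (deg L x + length todo)            ≡⟨ x∙yz≈y∙xz F (deg L x) (length todo) ⟩
            deg L x + (F + length todo)            ≤⟨ +-monoʳ-≤ (deg L x) budget′ ⟩
            deg L x + (suc f + slotCount ws)       ≡⟨ x∙yz≈y∙xz (deg L x) (suc f) (slotCount ws) ⟩
            suc f + (deg L x + slotCount ws)       ≡⟨ +-suc f (deg L x + slotCount ws) ⟨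
            f + slotCount (x ∷ ws)                 ∎ }
        where
        open ≤-Reasoning

        budget′ : F + length todo ≤ suc f + slotCount ws
        budget′ = s≤s⁻¹ (subst (_≤ suc (suc f) + slotCount ws) (+-suc F (length todo)) (budget e))

        reachable′ : ∀ {y} → y ∈ x ∷ ws → v ∼[ G ] y
        reachable′ (here refl) = reachable e (todo-∈ e (here refl)) ◅◅
          (Equivalence.to (complete L w x) (nth-∈ (neighbors L w) i eq) ◅ ε)
        reachable′ (there y∈ws) = reachable e y∈ws

        todo-∈′ : ∀ {y j} → (y , j) ∈ darts x (deg L x) ++ todo → y ∈ x ∷ ws
        todo-∈′ t with ∈-++⁻ (darts x (deg L x)) t
        ... | inj₂ t′ = there (todo-∈ e (there t′))
        ... | inj₁ t′ with ∈-map⁻ (x ,_) t′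
        ...   | _ , _ , refl = here refl

        frontier′ : ∀ {y z} → y ∈ x ∷ ws → T (adj G y z) →
                    z ∈ x ∷ ws ⊎ ∃[ j ] (y , j) ∈ darts x (deg L x) ++ todo × nth (neighbors L y) j ≡ just z
        frontier′ (here refl)  yz = inj₂ (∈-darts yz todo)
        frontier′ (there y∈ws) yz with frontier e y∈ws yz
        ... | inj₁ z∈ws                  = inj₁ (there z∈ws)
        ... | inj₂ (j , here refl , eq′) with trans (sym eq) eq′
        ...   | refl                     = inj₁ (here refl)
        frontier′ (there y∈ws) yz | inj₂ (j , there t , eq′) = inj₂ (j , ∈-++⁺ʳ (darts x (deg L x)) t , eq′)

      mutual
        explore-yields : ∀ f ws todo → Exploring F v f ws todo → Yields F v (explore f (withDegrees ws) todo)
        explore-yields zero    ws todo             e = ws , exhausted e , λ a b k → refl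
        explore-yields (suc f) ws []               e = ws , finished e , λ a b k → refl
        explore-yields (suc f) ws ((w , i) ∷ todo) e = visit-yields f ws w i todo (nth (neighbors L w) i) refl e

        visit-yields : ∀ f ws w i todo m → nth (neighbors L w) i ≡ m →
                       Exploring F v (suc f) ws ((w , i) ∷ todo) →
                       Yields F v (λ k → visit f (withDegrees ws) todo k m)
        visit-yields f ws w i todo nothing  eq e = explore-yields f ws todo (skip e λ eq′ → contradiction (trans (sym eq) eq′) λ ())
        visit-yields f ws w i todo (just x) eq e with found (withDegrees ws) x in x?
        ... | true  = explore-yields f ws todo (skip e known)
          where
          known : ∀ {y} → nth (neighbors L w) i ≡ just y → y ∈ ws
          known eq′ with trans (sym eq) eq′
          ... | refl = proj₁ (slot⇒∈ (subst T (sym x?) tt))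
        ... | false = enter-yields f ws w i todo x eq (λ x∈ws → contradiction (trans (sym x?) (slot-∈ x∈ws 0)) λ ()) e

        enter-yields : ∀ f ws w i todo x → nth (neighbors L w) i ≡ just x → x ∉ ws →
                       Exploring F v (suc f) ws ((w , i) ∷ todo) →
                       Yields F v (λ k → enter f (withDegrees ws) todo k x)
        -- The last query has also removed a queue entry, so the invariant gives F known slots even
        -- without those of x.
        enter-yields zero    ws w i todo x eq x∉ws e = ws , explored , λ a b k → refl
          where
          explored : Explored F v ws
          explored = record
            { distinct = distinct e ; source = source e ; reachable = reachable e
            ; outcome = inj₂ (≤-trans (m≤m+n F (length todo))
                                (s≤s⁻¹ (subst (_≤ suc (slotCount ws)) (+-suc F (length todo)) (budget e)))) }
        enter-yields (suc f) ws w i todo x eq x∉ws e =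
          explore-yields f (x ∷ ws) (darts x (deg L x) ++ todo) (extend e eq x∉ws)

    start-yields : ∀ f v → Yields (suc f) v (λ k → enter (suc f) [] [] k v)
    start-yields f v = explore-yields f (v ∷ []) (darts v (deg L v) ++ []) record
      { distinct = [] ∷ []
      ; source = here refl
      ; reachable = λ { (here refl) → ε }
      ; todo-∈ = todo-∈′
      ; frontier = λ { (here refl) vx → inj₂ (∈-darts {F = suc f} {v = v} vx []) }
      -- One query has been made, for the degree of v, and it is matched by the slot `(v , 0)`.
      ; budget = ≤-reflexive (begin-equality
          suc f + length (darts v (deg L v) ++ []) ≡⟨ cong (suc f +_) (length-darts {F = suc f} {v = v} v []) ⟩
          suc f + (deg L v + 0)                    ≡⟨ +-suc f (deg L v + 0) ⟨
          f + slotCount (v ∷ [])                   ∎) }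
      where
      open ≤-Reasoning
      todo-∈′ : ∀ {y j} → (y , j) ∈ darts v (deg L v) ++ [] → y ∈ v ∷ []
      todo-∈′ t with ∈-++⁻ (darts v (deg L v)) t
      ... | inj₁ t′ with ∈-map⁻ (v ,_) t′
      ...   | _ , _ , refl = here refl

  -- Comparing the earliest elements of different sets

  T-∧⁺ : ∀ {b c} → T b → T c → T (b ∧ c)
  T-∧⁺ p q = Equivalence.from T-∧ (p , q)

  T-∧⁻ : ∀ {b c} → T (b ∧ c) → T b × T c
  T-∧⁻ = Equivalence.to T-∧

  T-does⁺ : ∀ {P : Set} (P? : Dec P) → P → T (does P?)
  T-does⁺ P? p = subst T (sym (dec-true P? p)) tt

  T-does⁻ : ∀ {P : Set} (P? : Dec P) → T (does P?) → P
  T-does⁻ (yes p) _ = p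

  T-not : ∀ {b} → T (not b) → ¬ T b
  T-not {false} _ ()

  T⇒true : ∀ {b} → T b → b ≡ true
  T⇒true {true} _ = refl

  -- The witness is the earliest element of `b`. It remains the earliest in every smaller set that
  -- contains it, which lets a vertex with a partial view reach the verdict of its whole component.
  first-leader : ∀ {b : A → Bool} {x} xs → x ∈ xs → T (b x) →
                 Σ[ y ∈ A ] T (b y) ×
                 (∀ {b′} → (∀ z → T (b′ z) → T (b z)) → T (b′ y) → ∀ a → first a b′ xs ≡ a y)
  first-leader {A} {b} (x ∷ xs) x∈ bx with b x in eq
  ... | true  = x , subst T (sym eq) tt , λ {b′} _ b′x a → cong (λ c → if c then a x else first a b′ xs) (T⇒true b′x)
  ... | false with x∈
  ...   | here refl  = contradiction (subst T eq bx) λ ()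
  ...   | there x∈xs with first-leader xs x∈xs bx
  ...     | y , by , leads = y , by , later
    where
    later : ∀ {b′} → (∀ z → T (b′ z) → T (b z)) → T (b′ y) → ∀ a → first a b′ (x ∷ xs) ≡ a y
    later {b′} imp b′y a with b′ x in eq′
    ... | true  = contradiction (subst T eq (imp x (subst T (sym eq′) tt))) λ ()
    ... | false = leads imp b′y a

  -- Since `b` and `b′` hold at the same elements, both evaluations stop at the same entry.
  first-agree : ∀ {a a′ b b′ : A → Bool} → (∀ x → T (b x) → T (b′ x)) → (∀ x → T (b′ x) → T (b x)) →
                ∀ xs → T (first a b xs) → T (first a′ b′ xs) → Σ[ x ∈ A ] T (a x) × T (a′ x)
  first-agree {b = b} {b′} to from (x ∷ xs) p q with b x in eq | b′ x in eq′
  ... | true  | true  = x , p , q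
  ... | false | false = first-agree to from xs p q
  ... | true  | false = contradiction (subst T eq′ (to x (subst T (sym eq) tt))) λ ()
  ... | false | true  = contradiction (subst T eq (from x (subst T (sym eq′) tt))) λ ()

  -- Electing vertices

  -- A vertex has suc deg slots, of which the first F suffice: F known slots already make its election rare.
  slots : (n F : ℕ) → List (Slot n)
  slots n F = cartesianProduct (allFin n) (upTo F)

  owns : Fin n → Slot n → Bool
  owns v (w , _) = does (w Fin.≟ v)

  hasCenter : List (Fin n × ℕ) → Bool
  hasCenter {zero}  ws = false
  hasCenter {suc n} ws = found ws zero

  hasCenter⇒ : ∀ {G : Graph n} (L : NeighborLists G) {ws} → T (hasCenter (withDegrees L ws)) →
               Σ[ w ∈ Fin n ] w ∈ ws × T (center w)
  hasCenter⇒ {suc n} L t = zero , proj₁ (slot⇒∈ L t) , tt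

  hasCenter⇐ : ∀ {G : Graph n} (L : NeighborLists G) {ws c} → c ∈ ws → T (center c) → T (hasCenter (withDegrees L ws))
  hasCenter⇐ L {c = zero} c∈ws _ = subst T (sym (slot-∈ L c∈ws 0)) tt

  elect : List (Slot n) → List (Fin n × ℕ) → Fin n → Bool
  elect o ws v = not (hasCenter ws) ∧ first (λ s → slot ws s ∧ owns v s) (slot ws) o

  ∑-upTo≤ : ∀ d F → ∑ (upTo F) (λ i → ⟦ i ≤ᵇ d ⟧) ≤ suc d
  ∑-upTo≤ d F = begin
    ∑ (upTo F) (λ i → ⟦ i ≤ᵇ d ⟧)                 ≡⟨ length-filterᵇ (_≤ᵇ d) (upTo F) ⟨
    length (filterᵇ (_≤ᵇ d) (upTo F))             ≡⟨ ∑-one (filterᵇ (_≤ᵇ d) (upTo F)) ⟨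
    ∑ (filterᵇ (_≤ᵇ d) (upTo F)) (λ _ → 1)        ≤⟨ ∑-⊆ (filter⁺ (T? ∘ (_≤ᵇ d)) (upTo⁺ F)) (λ {i} i∈ → ∈-upTo⁺ (s≤s (≤ᵇ⇒≤ i d (proj₂ (∈-filter⁻ (T? ∘ (_≤ᵇ d)) {xs = upTo F} i∈))))) ⟩
    ∑ (upTo (suc d)) (λ _ → 1)                    ≡⟨ trans (∑-one (upTo (suc d))) (length-upTo (suc d)) ⟩
    suc d                                         ∎
    where open ≤-Reasoning

  ≤∑-upTo : ∀ d F → suc d ⊓ F ≤ ∑ (upTo F) (λ i → ⟦ i ≤ᵇ d ⟧)
  ≤∑-upTo d F = begin
    suc d ⊓ F                                     ≡⟨ trans (∑-one (upTo (suc d ⊓ F))) (length-upTo (suc d ⊓ F)) ⟨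
    ∑ (upTo (suc d ⊓ F)) (λ _ → 1)                ≤⟨ ∑-⊆ (upTo⁺ (suc d ⊓ F)) member ⟩
    ∑ (filterᵇ (_≤ᵇ d) (upTo F)) (λ _ → 1)        ≡⟨ ∑-one (filterᵇ (_≤ᵇ d) (upTo F)) ⟩
    length (filterᵇ (_≤ᵇ d) (upTo F))             ≡⟨ length-filterᵇ (_≤ᵇ d) (upTo F) ⟩
    ∑ (upTo F) (λ i → ⟦ i ≤ᵇ d ⟧)                 ∎
    where
    open ≤-Reasoning
    member : upTo (suc d ⊓ F) ⊆ filterᵇ (_≤ᵇ d) (upTo F)
    member {i} i∈ with ∈-upTo⁻ i∈
    ... | i< = ∈-filter⁺ (T? ∘ (_≤ᵇ d)) (∈-upTo⁺ (≤-trans i< (m⊓n≤n (suc d) F)))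
                         (≤⇒≤ᵇ (s≤s⁻¹ (≤-trans i< (m⊓n≤m (suc d) F))))

  ⊓-subadditive : ∀ a b c → (a + b) ⊓ c ≤ a ⊓ c + b ⊓ c
  ⊓-subadditive a b c with ≤-total a c | ≤-total b c
  ... | inj₂ c≤a | _        rewrite m≥n⇒m⊓n≡n c≤a = ≤-trans (m⊓n≤n (a + b) c) (m≤m+n c (b ⊓ c))
  ... | inj₁ _   | inj₂ c≤b rewrite m≥n⇒m⊓n≡n c≤b = ≤-trans (m⊓n≤n (a + b) c) (m≤n+m c (a ⊓ c))
  ... | inj₁ a≤c | inj₁ b≤c rewrite m≤n⇒m⊓n≡m a≤c | m≤n⇒m⊓n≡m b≤c = m⊓n≤m (a + b) c

  ∑-⊓ : ∀ (xs : List A) {f} c → ∑ xs f ⊓ c ≤ ∑ xs (λ x → f x ⊓ c)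
  ∑-⊓ []           c = z≤n
  ∑-⊓ (x ∷ xs) {f} c = ≤-trans (⊓-subadditive (f x) (∑ xs f) c) (+-monoʳ-≤ (f x ⊓ c) (∑-⊓ xs c))

  module _ {G : Graph n} (L : NeighborLists G) (F : ℕ) where

    -- Cutting every vertex down to F slots is harmless because the minimum with F is subadditive:
    -- the cut counts still add up to at least the minimum of F and the full count.
    many-slots : ∀ {ws} → Unique ws → F ≤ slotCount L ws →
                 F ≤ ∑ (slots n F) (λ s → ⟦ slot (withDegrees L ws) s ⟧)
    many-slots {ws} ws! F≤ = begin
      F                                                                    ≡⟨ m≥n⇒m⊓n≡n F≤ ⟨
      slotCount L ws ⊓ F                                                   ≤⟨ ∑-⊓ ws F ⟩
      ∑ ws (λ w → suc (deg L w) ⊓ F)                                       ≤⟨ ∑-mono ws (λ w → ≤∑-upTo (deg L w) F) ⟩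
      ∑ ws (λ w → ∑ (upTo F) λ i → ⟦ i ≤ᵇ deg L w ⟧)                       ≡⟨ ∑-cong-All {xs = ws} (All.tabulate λ {w} w∈ws → ∑-cong (upTo F) λ i → cong ⟦_⟧ (slot-∈ L w∈ws i)) ⟨
      ∑ ws (λ w → ∑ (upTo F) λ i → ⟦ slot (withDegrees L ws) (w , i) ⟧)    ≤⟨ ∑-⊆ ws! (λ {w} _ → ∈-allFin w) ⟩
      ∑ (allFin n) (λ w → ∑ (upTo F) λ i → ⟦ slot (withDegrees L ws) (w , i) ⟧) ≡⟨ ∑-× (allFin n) (upTo F) ⟨
      ∑ (slots n F) (λ s → ⟦ slot (withDegrees L ws) s ⟧)                  ∎
      where open ≤-Reasoning

    few-slots : ∀ ws v → ∑ (slots n F) (λ s → ⟦ slot (withDegrees L ws) s ∧ owns v s ⟧) ≤ suc (deg L v)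
    few-slots ws v = begin
      ∑ (slots n F) (λ s → ⟦ slot (withDegrees L ws) s ∧ owns v s ⟧)                            ≡⟨ ∑-× (allFin n) (upTo F) ⟩
      ∑ (allFin n) (λ w → ∑ (upTo F) λ i → ⟦ slot (withDegrees L ws) (w , i) ∧ owns v (w , i) ⟧) ≤⟨ ∑-mono (allFin n) (λ w → ∑-mono (upTo F) (bound w)) ⟩
      ∑ (allFin n) (λ w → ∑ (upTo F) λ i → ⟦ i ≤ᵇ deg L v ⟧ * ⟦ does (w Fin.≟ v) ⟧)             ≡⟨ ∑-cong (allFin n) (λ w → trans (∑-*ʳ (upTo F) ⟦ does (w Fin.≟ v) ⟧) (*-comm _ ⟦ does (w Fin.≟ v) ⟧)) ⟩
      ∑ (allFin n) (λ w → ⟦ does (w Fin.≟ v) ⟧ * ∑ (upTo F) λ i → ⟦ i ≤ᵇ deg L v ⟧)             ≡⟨ ∑-*ʳ (allFin n) _ ⟩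
      ∑ (allFin n) (λ w → ⟦ does (w Fin.≟ v) ⟧) * ∑ (upTo F) (λ i → ⟦ i ≤ᵇ deg L v ⟧)           ≤⟨ *-mono-≤ (∑-atMostOne (λ w → does (w Fin.≟ v)) same (allFin⁺ n)) (∑-upTo≤ (deg L v) F) ⟩
      1 * suc (deg L v)                                                                         ≡⟨ *-identityˡ (suc (deg L v)) ⟩
      suc (deg L v)                                                                             ∎
      where
      open ≤-Reasoning
      same : ∀ {x y} → T (does (x Fin.≟ v)) → T (does (y Fin.≟ v)) → x ≡ y
      same {x} {y} p q = trans (T-does⁻ (x Fin.≟ v) p) (sym (T-does⁻ (y Fin.≟ v) q))

      bound : ∀ w i → ⟦ slot (withDegrees L ws) (w , i) ∧ owns v (w , i) ⟧ ≤ ⟦ i ≤ᵇ deg L v ⟧ * ⟦ does (w Fin.≟ v) ⟧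
      bound w i with w Fin.≟ v
      ... | no  _    = ≤-trans (⟦⟧-≤ {c = false} (proj₂ ∘ T-∧⁻ {slot (withDegrees L ws) (w , i)})) z≤n
      ... | yes refl = ≤-trans (⟦⟧-≤ (λ t → proj₂ (slot⇒∈ L {ws} {w} {i} (proj₁ (T-∧⁻ t)))))
                               (≤-reflexive (sym (*-identityʳ ⟦ i ≤ᵇ deg L w ⟧)))

  -- Analysis of the election: connectivity, unavoidable edges and excess edges

  module Election {G : Graph n} (L : NeighborLists G) (f : ℕ) where

    F : ℕ
    F = suc f

    V : List (Fin n)
    V = allFin n

    Orders : List (List (Slot n))
    Orders = orders (length (slots n F)) (slots n F)

    seen : Fin n → List (Fin n)
    seen v = proj₁ (start-yields L f v)

    explored : ∀ v → Explored L F v (seen v)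
    explored v = proj₁ (proj₂ (start-yields L f v))

    view : Fin n → List (Fin n × ℕ)
    view v = withDegrees L (seen v)

    open Explored

    selected : List (Slot n) → Fin n → Bool
    selected o v = elect o (view v) v

    -- This records the branch of `outcome`. A search whose budget ends just as its queue becomes
    -- empty counts as not exhaustive, and is then covered by the bound on slots.
    exhaustive : Fin n → Bool
    exhaustive v with outcome (explored v)
    ... | inj₁ _ = true
    ... | inj₂ _ = false

    exhaustive⇒ : ∀ {v} → T (exhaustive v) → ∀ {w} → v ∼[ G ] w → w ∈ seen v
    exhaustive⇒ {v} t with outcome (explored v)
    ... | inj₁ closed = follow (source (explored v))
      where
      follow : ∀ {x w} → x ∈ seen v → x ∼[ G ] w → w ∈ seen v
      follow x∈ ε        = x∈
      follow x∈ (e ◅ es) = follow (closed x∈ e) es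

    selected⇒leader : ∀ o v → T (selected o v) →
      T (not (hasCenter (view v))) × T (first (λ s → slot (view v) s ∧ owns v s) (slot (view v)) o)
    selected⇒leader o v = T-∧⁻

    -- Let w own the earliest slot of the component of v. The view of w stays inside the component
    -- and contains the slots of w, so this slot is the earliest there too. Hence w is selected
    -- unless its view shows the center, which then is reachable itself.
    selected-reaches : ∀ {o} → slots n F ⊆ o → ∀ v → Σ[ w ∈ Fin n ] v ∼[ G ] w × T (center w ∨ selected o w)
    -- The component has a slot in the order, namely `(v , 0)`, because F is positive.
    selected-reaches {o} all v with first-leader {b = inComponent} o (all (∈-cartesianProduct⁺ (∈-allFin v) (∈-upTo⁺ {F} (s≤s z≤n)))) inSelf
      where
      inComponent : Slot n → Bool
      inComponent (w , i) = does (component G v Fin.≟ component G w) ∧ (i ≤ᵇ deg L w)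
      inSelf : T (inComponent (v , 0))
      inSelf = T-∧⁺ (T-does⁺ (component G v Fin.≟ component G v) refl) tt
    ... | (w , i) , t , leads with T-∧⁻ {does (component G v Fin.≟ component G w)} t
    ...   | same , i≤deg = winner
      where
      v∼w : v ∼[ G ] w
      v∼w = component-sound G (T-does⁻ (component G v Fin.≟ component G w) same)

      inView : T (slot (view w) (w , i))
      inView = subst T (sym (slot-∈ L (source (explored w)) i)) i≤deg

      narrower : ∀ s → T (slot (view w) s) → T (does (component G v Fin.≟ component G (proj₁ s)) ∧ (proj₂ s ≤ᵇ deg L (proj₁ s)))
      narrower (x , j) t′ with slot⇒∈ L {seen w} {x} {j} t′
      ... | x∈ , j≤ = T-∧⁺ (T-does⁺ (component G v Fin.≟ component G x) (component-complete G (v∼w ◅◅ reachable (explored w) x∈))) j≤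

      wins : T (first (λ s → slot (view w) s ∧ owns w s) (slot (view w)) o)
      wins = subst T (sym (leads narrower inView (λ s → slot (view w) s ∧ owns w s)))
                     (T-∧⁺ inView (T-does⁺ (w Fin.≟ w) refl))

      winner : Σ[ x ∈ Fin n ] v ∼[ G ] x × T (center x ∨ selected o x)
      winner with hasCenter (view w) in eq
      ... | false = w , v∼w , T-∨ʳ (center w) (T-∧⁺ (subst (T ∘ not) (sym eq) tt) wins)
      ... | true with hasCenter⇒ L {seen w} (subst T (sym eq) tt)
      ...   | x , x∈ , c = x , v∼w ◅◅ reachable (explored w) x∈ , T-∨ˡ c

    -- Exhaustive views within one component contain the same slots, so both elections end at one
    -- slot, which has only one owner.
    leaders-differ : ∀ {o v w} → T (selected o v) → T (exhaustive v) → T (selected o w) → T (exhaustive w) →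
                     component G v ≡ component G w → v ≡ w
    leaders-differ {o} {v} {w} sv xv sw xw eq
      with first-agree (transfer v w v∼w xw) (transfer w v (∼-sym G v∼w) xv) o
             (proj₂ (selected⇒leader o v sv)) (proj₂ (selected⇒leader o w sw))
      where
      v∼w = component-sound G eq
      transfer : ∀ x y → x ∼[ G ] y → T (exhaustive y) → ∀ s → T (slot (view x) s) → T (slot (view y) s)
      transfer x y x∼y xy (z , i) t with slot⇒∈ L {seen x} {z} {i} t
      ... | z∈ , i≤ = subst T (sym (slot-∈ L (exhaustive⇒ {y} xy (∼-sym G x∼y ◅◅ reachable (explored x) z∈)) i)) i≤
    ... | (x , i) , ax , ax′ = trans (sym (T-does⁻ (x Fin.≟ v) (proj₂ (T-∧⁻ {slot (view v) (x , i)} ax))))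
                                     (T-does⁻ (x Fin.≟ w) (proj₂ (T-∧⁻ {slot (view w) (x , i)} ax′)))

    -- Selected vertices are split by what pays for them: `local` ones are charged to the
    -- differences from any connected graph, for every order; `excess` ones are bounded only on
    -- average.
    local : List (Slot n) → Fin n → Bool
    local o v = selected o v ∧ exhaustive v

    excess : List (Slot n) → Fin n → Bool
    excess o v = selected o v ∧ not (exhaustive v)

    local-separated : ∀ o {vs} → All (T ∘ local o) vs → Unique vs → Separated (component G) vs
    local-separated o []       []         = []
    local-separated o (p ∷ ps) (v# ∷ vs#) =
      All.zipWith (λ (q , v≢w) eq → v≢w (leaders-differ {o} (proj₁ (T-∧⁻ p)) (proj₂ (T-∧⁻ p)) (proj₁ (T-∧⁻ q)) (proj₂ (T-∧⁻ q)) eq)) (ps , v#)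
      ∷ local-separated o ps vs#

    local-away : ∀ o {v} → T (local o v) → ∀ c → T (center c) → component G c ≢ component G v
    local-away o {v} t c tc eq with T-∧⁻ {selected o v} t
    ... | sel , xv = T-not (proj₁ (selected⇒leader o v sel)) (hasCenter⇐ L (exhaustive⇒ {v} xv (component-sound G (sym eq))) tc)

    local≤differences : ∀ o (H : Graph n) → Connected H → ∑ V (λ v → ⟦ local o v ⟧) ≤ differenceCount G H
    local≤differences o H conn = begin
      ∑ V (λ v → ⟦ local o v ⟧)      ≡⟨ length-filterᵇ (local o) V ⟨
      length (filterᵇ (local o) V)   ≤⟨ separated≤differences G H conn
                                          (local-separated o all-local (filter⁺ (T? ∘ local o) (allFin⁺ n)))
                                          (All.map (λ {v} → local-away o {v}) all-local) ⟩
      differenceCount G H            ∎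
      where
      open ≤-Reasoning
      all-local = all-filter (T? ∘ local o) V

    excessCount : List (Slot n) → ℕ
    excessCount o = ∑ V λ v → ⟦ excess o v ⟧

    selected-differences : ∀ o (H : Graph n) → Connected H →
                           differenceCount G (attach G (selected o)) ≤ differenceCount G H + excessCount o
    selected-differences o H conn = begin
      differenceCount G (attach G (selected o))                    ≤⟨ attach-differences G (selected o) ⟩
      ∑ V (λ v → ⟦ selected o v ⟧)                                 ≡⟨ ∑-cong V (λ v → split (selected o v) (exhaustive v)) ⟩
      ∑ V (λ v → ⟦ local o v ⟧ + ⟦ excess o v ⟧)                   ≡⟨ ∑-+ V ⟩
      ∑ V (λ v → ⟦ local o v ⟧) + excessCount o                    ≤⟨ +-monoˡ-≤ (excessCount o) (local≤differences o H conn) ⟩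
      differenceCount G H + excessCount o                          ∎
      where
      open ≤-Reasoning
      split : ∀ b c → ⟦ b ⟧ ≡ ⟦ b ∧ c ⟧ + ⟦ b ∧ not c ⟧
      split true  true  = refl
      split true  false = refl
      split false c     = refl

    -- For a fixed view the chance of v is the ratio of its own slots to all known slots. The former
    -- are at most `suc (deg L v)`, the latter at least F.
    excess-probability : ∀ v → ∑ Orders (λ o → ⟦ excess o v ⟧) * F ≤ suc (deg L v) * length Orders
    excess-probability v with outcome (explored v)
    ... | inj₁ _  = begin
      ∑ Orders (λ o → ⟦ selected o v ∧ false ⟧) * F ≡⟨ cong (_* F) (∑-cong Orders (λ o → none (selected o v))) ⟩
      ∑ Orders (λ o → 0) * F                        ≡⟨ cong (_* F) (∑-zero Orders) ⟩
      0                                             ≤⟨ z≤n ⟩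
      suc (deg L v) * length Orders                 ∎
      where
      open ≤-Reasoning
      none : ∀ b → ⟦ b ∧ false ⟧ ≡ 0
      none true  = refl
      none false = refl
    ... | inj₂ F≤ = begin
      ∑ Orders (λ o → ⟦ selected o v ∧ true ⟧) * F                      ≤⟨ *-monoˡ-≤ F (∑-mono Orders (λ o → ⟦⟧-≤ (λ t → proj₂ (selected⇒leader o v (proj₁ (T-∧⁻ t)))))) ⟩
      ∑ Orders (λ o → ⟦ first mine b o ⟧) * F                           ≤⟨ *-monoʳ-≤ (∑ Orders (λ o → ⟦ first mine b o ⟧)) (many-slots L F (distinct (explored v)) F≤) ⟩
      ∑ Orders (λ o → ⟦ first mine b o ⟧) * ∑ (slots n F) (λ s → ⟦ b s ⟧) ≡⟨ orders-first (λ s eq → cong (_∧ owns v s) eq) _ (slots n F) refl ⟩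
      ∑ (slots n F) (λ s → ⟦ mine s ⟧) * (length (slots n F)) !         ≤⟨ *-monoˡ-≤ ((length (slots n F)) !) (few-slots L F (seen v) v) ⟩
      suc (deg L v) * (length (slots n F)) !                            ≡⟨ cong (suc (deg L v) *_) (length-orders _ (slots n F) refl) ⟨
      suc (deg L v) * length Orders                                     ∎
      where
      open ≤-Reasoning
      b mine : Slot n → Bool
      b      = slot (view v)
      mine s = b s ∧ owns v s

    expected-excess : ∑ Orders excessCount * F ≤ (n + (edgeCount G + edgeCount G)) * length Orders
    expected-excess = begin
      ∑ Orders excessCount * F                               ≡⟨ cong (_* F) (∑-swap Orders V) ⟩
      ∑ V (λ v → ∑ Orders (λ o → ⟦ excess o v ⟧)) * F        ≡⟨ ∑-*ʳ V F ⟨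
      ∑ V (λ v → ∑ Orders (λ o → ⟦ excess o v ⟧) * F)        ≤⟨ ∑-mono V excess-probability ⟩
      ∑ V (λ v → suc (deg L v) * length Orders)              ≡⟨ ∑-*ʳ V (length Orders) ⟩
      ∑ V (λ v → 1 + deg L v) * length Orders                ≡⟨ cong (_* length Orders) (trans (∑-+ V) (cong (_+ ∑ V (deg L)) (trans (∑-one V) (length-tabulate {n = n} (λ i → i))))) ⟩
      (n + ∑ V (deg L)) * length Orders                      ≤⟨ *-monoˡ-≤ (length Orders) (+-monoʳ-≤ n (∑-deg L)) ⟩
      (n + (edgeCount G + edgeCount G)) * length Orders      ∎
      where open ≤-Reasoning

open import Data.Rational.Base using (ℚ; mkℚ; 0ℚ; 1ℚ; _/_; _+_; _*_; _-_; -_; _≤_; _<_; *<*; toℚᵘ; positive; nonNegative; >-nonZero; ↧ₙ_)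
open import Data.Rational.Properties
open import Data.Rational.Solver using (module +-*-Solver)

private variable
  A : Set

-- Rational arithmetic

/-* : ∀ k m .{{_ : ℕ.NonZero m}} → (ℤ.+ k / m) * fromℕ m ≡ fromℕ k
/-* k (suc m) = toℚᵘ-injective (begin
  toℚᵘ ((ℤ.+ k / suc m) * fromℕ (suc m))                        ≈⟨ toℚᵘ-homo-* (ℤ.+ k / suc m) (fromℕ (suc m)) ⟩
  toℚᵘ (ℤ.+ k / suc m) ℚᵘ.* toℚᵘ (fromℕ (suc m))                ≈⟨ ℚᵘ.*-cong (toℚᵘ-fromℚᵘ (ℚᵘ.mkℚᵘ (ℤ.+ k) m)) (toℚᵘ-fromℚᵘ (ℚᵘ.mkℚᵘ (ℤ.+ suc m) 0)) ⟩
  ℚᵘ.mkℚᵘ (ℤ.+ k) m ℚᵘ.* ℚᵘ.mkℚᵘ (ℤ.+ suc m) 0                  ≈⟨ ℚᵘ.*≡* (trans (ℤ.*-identityʳ _) (cong (λ d → ℤ.+ k ℤ.* ℤ.+ d) (sym (ℕ.*-identityʳ (suc m))))) ⟩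
  ℚᵘ.mkℚᵘ (ℤ.+ k) 0                                             ≈⟨ toℚᵘ-fromℚᵘ (ℚᵘ.mkℚᵘ (ℤ.+ k) 0) ⟨
  toℚᵘ (fromℕ k)                                                ∎)
  where open ℚᵘ.≃-Reasoning

fromℕ-+ : ∀ a b → fromℕ (a ℕ.+ b) ≡ fromℕ a + fromℕ b
fromℕ-+ a b = toℚᵘ-injective (begin
  toℚᵘ (fromℕ (a ℕ.+ b))                             ≈⟨ toℚᵘ-fromℚᵘ (ℚᵘ.mkℚᵘ (ℤ.+ (a ℕ.+ b)) 0) ⟩
  ℚᵘ.mkℚᵘ (ℤ.+ (a ℕ.+ b)) 0                          ≈⟨ ℚᵘ.*≡* (cong (ℤ._* ℤ.1ℤ) (sym (cong₂ ℤ._+_ (ℤ.*-identityʳ (ℤ.+ a)) (ℤ.*-identityʳ (ℤ.+ b))))) ⟩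
  ℚᵘ.mkℚᵘ (ℤ.+ a) 0 ℚᵘ.+ ℚᵘ.mkℚᵘ (ℤ.+ b) 0           ≈⟨ ℚᵘ.+-cong (toℚᵘ-fromℚᵘ (ℚᵘ.mkℚᵘ (ℤ.+ a) 0)) (toℚᵘ-fromℚᵘ (ℚᵘ.mkℚᵘ (ℤ.+ b) 0)) ⟨
  toℚᵘ (fromℕ a) ℚᵘ.+ toℚᵘ (fromℕ b)                 ≈⟨ toℚᵘ-homo-+ (fromℕ a) (fromℕ b) ⟨
  toℚᵘ (fromℕ a + fromℕ b)                           ∎)
  where open ℚᵘ.≃-Reasoning

fromℕ-* : ∀ a b → fromℕ (a ℕ.* b) ≡ fromℕ a * fromℕ b
fromℕ-* zero    b = sym (*-zeroˡ (fromℕ b))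
fromℕ-* (suc a) b = begin
  fromℕ (b ℕ.+ a ℕ.* b)              ≡⟨ fromℕ-+ b (a ℕ.* b) ⟩
  fromℕ b + fromℕ (a ℕ.* b)          ≡⟨ cong₂ _+_ (sym (*-identityˡ (fromℕ b))) (fromℕ-* a b) ⟩
  1ℚ * fromℕ b + fromℕ a * fromℕ b   ≡⟨ *-distribʳ-+ (fromℕ b) 1ℚ (fromℕ a) ⟨
  (1ℚ + fromℕ a) * fromℕ b           ≡⟨ cong (_* fromℕ b) (fromℕ-+ 1 a) ⟨
  fromℕ (suc a) * fromℕ b            ∎
  where open ≡-Reasoning

0≤fromℕ : ∀ a → 0ℚ ≤ fromℕ a
0≤fromℕ a = nonNegative⁻¹ (fromℕ a) {{normalize-nonNeg a 1}}

0<fromℕ : ∀ a .{{_ : ℕ.NonZero a}} → 0ℚ < fromℕ a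
0<fromℕ a = positive⁻¹ (fromℕ a) {{normalize-pos a 1}}

fromℕ-mono : ∀ {a b} → a ℕ.≤ b → fromℕ a ≤ fromℕ b
fromℕ-mono {a} {b} a≤b = subst₂ _≤_ (+-identityʳ (fromℕ a)) (trans (sym (fromℕ-+ a (b ℕ.∸ a))) (cong fromℕ (ℕ.m+[n∸m]≡n a≤b)))
                           (+-monoʳ-≤ (fromℕ a) (0≤fromℕ (b ℕ.∸ a)))

*-monoˡ : ∀ {p q r} → 0ℚ ≤ r → p ≤ q → p * r ≤ q * r
*-monoˡ {r = r} 0≤r = *-monoʳ-≤-nonNeg r {{nonNegative 0≤r}}

*-monoʳ : ∀ {p q r} → 0ℚ ≤ r → p ≤ q → r * p ≤ r * q
*-monoʳ {r = r} 0≤r = *-monoˡ-≤-nonNeg r {{nonNegative 0≤r}}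

*-cancelʳ : ∀ {p q r} → 0ℚ < r → p * r ≤ q * r → p ≤ q
*-cancelʳ {r = r} 0<r = *-cancelʳ-≤-pos r {{positive 0<r}}

0≤* : ∀ {p q} → 0ℚ ≤ p → 0ℚ ≤ q → 0ℚ ≤ p * q
0≤* {p} {q} 0≤p 0≤q = subst (_≤ p * q) (*-zeroˡ q) (*-monoˡ 0≤q 0≤p)

/≤ : ∀ k m .{{_ : ℕ.NonZero m}} {p} → fromℕ k ≤ p * fromℕ m → ℤ.+ k / m ≤ p
/≤ k m {p} le = *-cancelʳ (0<fromℕ m) (subst (_≤ p * fromℕ m) (sym (/-* k m)) le)

/≤⁻ : ∀ k m .{{_ : ℕ.NonZero m}} {p} → ℤ.+ k / m ≤ p → fromℕ k ≤ p * fromℕ m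
/≤⁻ k m {p} le = subst (_≤ p * fromℕ m) (/-* k m) (*-monoˡ (0≤fromℕ m) le)

≤/ : ∀ k m .{{_ : ℕ.NonZero m}} {p} → p * fromℕ m ≤ fromℕ k → p ≤ ℤ.+ k / m
≤/ k m {p} le = *-cancelʳ (0<fromℕ m) (subst (p * fromℕ m ≤_) (sym (/-* k m)) le)

*-reciprocal : ∀ p (p>0 : 0ℚ < p) → p * reciprocal p p>0 ≡ 1ℚ
*-reciprocal p p>0 = *-inverseʳ p {{>-nonZero p>0}}

reciprocal>0 : ∀ p (p>0 : 0ℚ < p) → 0ℚ < reciprocal p p>0
reciprocal>0 p p>0 = positive⁻¹ _ {{1/pos⇒pos p {{positive p>0}}}}

round-up : ∀ p → 0ℚ < p → Σ[ k ∈ ℕ ] p ≤ fromℕ k × fromℕ k ≤ p + 1ℚ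
round-up p p>0 = quotient p (↧ₙ p) (numerator p p>0)
  where
  open ≤-Reasoning

  numerator : ∀ p → 0ℚ < p → Σ[ a ∈ ℕ ] p * fromℕ (↧ₙ p) ≡ fromℕ a
  numerator p@(mkℚ (ℤ.+ a) d-1 _) _ = a , trans (cong (_* fromℕ (suc d-1)) (sym (↥p/↧p≡p p))) (/-* a (suc d-1))
  numerator (mkℚ ℤ.-[1+ _ ] _ _) (*<* ())

  quotient : ∀ p d .{{_ : ℕ.NonZero d}} → Σ[ a ∈ ℕ ] p * fromℕ d ≡ fromℕ a →
             Σ[ k ∈ ℕ ] p ≤ fromℕ k × fromℕ k ≤ p + 1ℚ
  -- Here p is a / d and `q` is its floor, so `suc q` lies above p by at most one.
  quotient p d (a , p*d) = suc q ,
    *-cancelʳ (0<fromℕ d) (begin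
      p * fromℕ d                    ≡⟨ p*d ⟩
      fromℕ a                        ≤⟨ fromℕ-mono a≤k*d ⟩
      fromℕ (suc q ℕ.* d)            ≡⟨ fromℕ-* (suc q) d ⟩
      fromℕ (suc q) * fromℕ d        ∎) ,
    *-cancelʳ (0<fromℕ d) (begin
      fromℕ (suc q) * fromℕ d        ≡⟨ fromℕ-* (suc q) d ⟨
      fromℕ (d ℕ.+ q ℕ.* d)          ≤⟨ fromℕ-mono (ℕ.+-monoʳ-≤ d (ℕ.m/n*n≤m a d)) ⟩
      fromℕ (d ℕ.+ a)                ≡⟨ fromℕ-+ d a ⟩
      fromℕ d + fromℕ a              ≡⟨ +-comm (fromℕ d) (fromℕ a) ⟩
      fromℕ a + fromℕ d              ≡⟨ cong₂ _+_ (sym p*d) (sym (*-identityˡ (fromℕ d))) ⟩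
      p * fromℕ d + 1ℚ * fromℕ d     ≡⟨ *-distribʳ-+ (fromℕ d) p 1ℚ ⟨
      (p + 1ℚ) * fromℕ d             ∎)
    where
    q = a ℕ./ d

    a≤k*d : a ℕ.≤ suc q ℕ.* d
    a≤k*d = subst (ℕ._≤ d ℕ.+ q ℕ.* d) (sym (ℕ.m≡m%n+[m/n]*n a d))
                  (ℕ.+-monoˡ-≤ (q ℕ.* d) (ℕ.<⇒≤ (ℕ.m%n<n a d)))

-- Markov's inequality and the failure probability

markov : (xs : List A) (X : A → ℕ) {t : ℚ} → 0ℚ ≤ t →
         fromℕ (∑ xs (λ x → ⟦ not (does (fromℕ (X x) ≤? t)) ⟧)) * t ≤ fromℕ (∑ xs X)
markov []       X {t} 0≤t = ≤-reflexive (*-zeroˡ t)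
markov (x ∷ xs) X {t} 0≤t = begin
  fromℕ (b ℕ.+ bad) * t          ≡⟨ cong (_* t) (fromℕ-+ b bad) ⟩
  (fromℕ b + fromℕ bad) * t      ≡⟨ *-distribʳ-+ t (fromℕ b) (fromℕ bad) ⟩
  fromℕ b * t + fromℕ bad * t    ≤⟨ +-mono-≤ (step (fromℕ (X x) ≤? t)) (markov xs X 0≤t) ⟩
  fromℕ (X x) + fromℕ (∑ xs X)   ≡⟨ fromℕ-+ (X x) (∑ xs X) ⟨
  fromℕ (X x ℕ.+ ∑ xs X)         ∎
  where
  open ≤-Reasoning
  b   = ⟦ not (does (fromℕ (X x) ≤? t)) ⟧
  bad = ∑ xs (λ x → ⟦ not (does (fromℕ (X x) ≤? t)) ⟧)

  step : (X≤t? : Dec (fromℕ (X x) ≤ t)) → fromℕ ⟦ not (does X≤t?) ⟧ * t ≤ fromℕ (X x)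
  step (yes _)  = subst (_≤ fromℕ (X x)) (sym (*-zeroˡ t)) (0≤fromℕ (X x))
  step (no X≰t) = subst (_≤ fromℕ (X x)) (sym (*-identityˡ t)) (<⇒≤ (≰⇒> X≰t))

-- Here r is 1/c, N is the number of orders, X the excess summed over all orders, and `good` and
-- `bad` count the orders below and above the threshold αεm. With K = r + 2 the chain is bad·K·m ≤
-- bad·Fδαε·m ≤ δXF ≤ δ(n + 2E)N ≤ δKmN, and Km cancels.
failure-bound : ∀ {δ α ε r m n E F N X good bad} →
  0ℚ ≤ δ → 0ℚ < m → 0ℚ < r → 0ℚ ≤ F → 0ℚ ≤ N → 0ℚ ≤ bad →
  r + (1ℚ + 1ℚ) ≤ F * (δ * α * ε) →
  n ≤ r * m → E ≤ m →
  bad * (α * ε * m) ≤ X → X * F ≤ (n + (E + E)) * N →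
  good + bad ≡ N → (1ℚ - δ) * N ≤ good
failure-bound {δ} {α} {ε} {r} {m} {n} {E} {F} {N} {X} {good} {bad}
              0≤δ 0<m 0<r 0≤F 0≤N 0≤bad fuel n≤ E≤ markov≤ mean≤ total = begin
  (1ℚ - δ) * N               ≡⟨ solve 2 (λ d N → (con 1ℚ :- d) :* N := N :- d :* N) refl δ N ⟩
  N - δ * N                  ≡⟨ cong (_- δ * N) total ⟨
  good + bad - δ * N         ≤⟨ +-monoˡ-≤ (- (δ * N)) (+-monoʳ-≤ good bad≤) ⟩
  good + δ * N - δ * N       ≡⟨ solve 2 (λ g x → g :+ x :- x := g) refl good (δ * N) ⟩
  good                       ∎
  where
  open ≤-Reasoning
  open +-*-Solver using (solve; _:=_; _:+_; _:*_; _:-_; con)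

  K : ℚ
  K = r + (1ℚ + 1ℚ)

  0<K : 0ℚ < K
  0<K = subst (_< K) (+-identityˡ 0ℚ) (+-mono-<-≤ 0<r (0≤fromℕ 2))

  pairs : n + (E + E) ≤ K * m
  pairs = begin
    n + (E + E)       ≤⟨ +-mono-≤ n≤ (+-mono-≤ E≤ E≤) ⟩
    r * m + (m + m)   ≡⟨ solve 2 (λ r m → r :* m :+ (m :+ m) := (r :+ (con 1ℚ :+ con 1ℚ)) :* m) refl r m ⟩
    K * m             ∎

  bad≤ : bad ≤ δ * N
  bad≤ = *-cancelʳ (*-pos 0<K 0<m) (begin
    bad * (K * m)                      ≤⟨ *-monoʳ 0≤bad (*-monoˡ (<⇒≤ 0<m) fuel) ⟩
    bad * (F * (δ * α * ε) * m)        ≡⟨ solve 6 (λ b f d a e m → b :* (f :* (d :* a :* e) :* m) := d :* (b :* (a :* e :* m) :* f)) refl bad F δ α ε m ⟩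
    δ * (bad * (α * ε * m) * F)        ≤⟨ *-monoʳ 0≤δ (*-monoˡ 0≤F markov≤) ⟩
    δ * (X * F)                        ≤⟨ *-monoʳ 0≤δ mean≤ ⟩
    δ * ((n + (E + E)) * N)            ≤⟨ *-monoʳ 0≤δ (*-monoˡ 0≤N pairs) ⟩
    δ * (K * m * N)                    ≡⟨ solve 4 (λ d k m N → d :* (k :* m :* N) := d :* N :* (k :* m)) refl δ K m N ⟩
    δ * N * (K * m)                    ∎)

-- Events

event : (xs : List A) → (A → Bool) → Subset (length xs)
event xs p = tabulate λ s → p (lookup xs s)

∣event∣ : ∀ (xs : List A) (p : A → Bool) → ∣ event xs p ∣ ≡ ∑ xs (λ x → ⟦ p x ⟧)
∣event∣ []       p = refl
∣event∣ (x ∷ xs) p with p x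
... | true  = cong suc (∣event∣ xs p)
... | false = ∣event∣ xs p

∈-event : ∀ (xs : List A) (p : A → Bool) s → s ∈ₛ event xs p → T (p (lookup xs s))
∈-event xs p s s∈ = subst T (trans (sym ([]=⇒lookup s∈)) (lookup∘tabulate (λ s → p (lookup xs s)) s)) tt

constant-queries : ∀ {P : Property} {c ε} (R : Algorithm) b →
  ((I : Input c P ε) → ∀ s u v → queries R I s u v ℕ.≤ b) →
  ∀ η → 0ℚ < η → Σ[ M ∈ ℕ ] ((I : Input c P ε) → M ℕ.≤ Input.m I → QueriesAtMost R I (η * fromℕ (Input.m I)))
constant-queries R b bound η 0<η = proj₁ M , λ I M≤m s u v →
  ≤-trans (fromℕ-mono (ℕ.m≤n⇒m≤1+n (bound I s u v)))
          (scale (fromℕ (suc b)) (reciprocal η 0<η) (*-reciprocal η 0<η)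
                 (≤-trans (proj₁ (proj₂ M)) (fromℕ-mono M≤m)))
  where
  open ≤-Reasoning
  open +-*-Solver using (solve; _:=_; _:+_; _:*_; _:-_; con)

  -- From m ≥ (b + 1)/η on, the constant is at most ηm; the added one keeps the argument of
  -- `round-up` positive even for b = 0.
  M = round-up (fromℕ (suc b) * reciprocal η 0<η) (*-pos (0<fromℕ (suc b)) (reciprocal>0 η 0<η))

  scale : ∀ b r {m} → η * r ≡ 1ℚ → b * r ≤ m → b ≤ η * m
  scale b r {m} η*r le = begin
    b              ≡⟨ *-identityʳ b ⟨
    b * 1ℚ         ≡⟨ cong (b *_) η*r ⟨
    b * (η * r)    ≡⟨ solve 3 (λ b h r → b :* (h :* r) := h :* (b :* r)) refl b η r ⟩
    η * (b * r)    ≤⟨ *-monoʳ (<⇒≤ 0<η) le ⟩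
    η * m          ∎

-- The algorithms

starAlgorithm : Algorithm
starAlgorithm .seeds   _ _ = 1
starAlgorithm .seeds≢0 _ _ = _
starAlgorithm .answer  _ _ _ u v = output (adj star u v)

decide : ∀ {n} → ℕ → List (Slot n) → Fin n → Computation n
decide f o v = enter (suc f) [] [] (λ ws → output (elect o ws v)) v

-- The search starts from the end that is not the center, whichever comes first in the query; this
-- makes the replies symmetric.
test : ∀ {n} → ℕ → List (Slot n) → (u v : Fin n) → Computation n
test f o zero    zero    = output false
test f o zero    (suc v) = decide f o (suc v)
test f o (suc u) zero    = decide f o (suc u)
test f o (suc u) (suc v) = output false

slotOrders : (n f : ℕ) → List (List (Slot n))
slotOrders n f = orders (length (slots n (suc f))) (slots n (suc f))

slotOrders≢[] : ∀ n f → ℕ.NonZero (length (slotOrders n f))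
slotOrders≢[] n f = subst ℕ.NonZero (sym (length-orders _ (slots n (suc f)) refl)) (length (slots n (suc f)) ℕ.!≢0)

electionAlgorithm : ℕ → Algorithm
electionAlgorithm f .seeds   n m = length (slotOrders n f)
electionAlgorithm f .seeds≢0 n m = slotOrders≢[] n f
electionAlgorithm f .answer  n m s u v =
  present λ b → if b then output true else test f (lookup (slotOrders n f) s) u v

module _ {n} {G : Graph n} (L : NeighborLists G) (f : ℕ) where

  open Election L f

  cost-test : ∀ o a b u v → cost L a b (test f o u v) ℕ.≤ suc f
  cost-test o a b zero    zero    = z≤n
  cost-test o a b zero    (suc v) = cost-enter L a b (λ _ → refl) (suc f) [] [] (suc v)
  cost-test o a b (suc u) zero    = cost-enter L a b (λ _ → refl) (suc f) [] [] (suc u)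
  cost-test o a b (suc u) (suc v) = z≤n

  run-decide : ∀ o a b v → run L a b (decide f o v) ≡ selected o v
  run-decide o a b v = proj₂ (proj₂ (start-yields L f v)) a b (λ ws → output (elect o ws v))

  run-test : ∀ o a b u v → run L a b (test f o u v) ≡ link (selected o) u v
  run-test o a b zero    zero    = refl
  run-test o a b zero    (suc v) = run-decide o a b (suc v)
  run-test o a b (suc u) zero    = run-decide o a b (suc u)
  run-test o a b (suc u) (suc v) = refl

election-cost : ∀ f {c} {P : Property} {ε} (I : Input c P ε) s u v → queries (electionAlgorithm f) I s u v ℕ.≤ suc (suc f)
election-cost f I s u v with adj (Input.G I) u v
... | true  = s≤s z≤n
... | false = s≤s (cost-test (Input.lists I) f _ u v u v)

election-reply : ∀ f {c} {P : Property} {ε} (I : Input c P ε) s u v →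
  reply (electionAlgorithm f) I s u v ≡
  adj (attach (Input.G I) (Election.selected (Input.lists I) f (lookup (slotOrders (Input.n I) f) s))) u v
election-reply f I s u v with adj (Input.G I) u v
... | true  = refl
... | false = run-test (Input.lists I) f _ u v u v

-- This is how m = Ω(n) enters: the degree slots, one per vertex, are bounded by a multiple of m.
vertices≤ : ∀ {c} (c>0 : 0ℚ < c) {P : Property} {ε} (I : Input c P ε) →
            fromℕ (Input.n I) ≤ reciprocal c c>0 * fromℕ (Input.m I)
vertices≤ {c} c>0 I = scale {c} (*-reciprocal c c>0) (<⇒≤ (reciprocal>0 c c>0)) (Input.m=Ω[n] I)
  where
  open ≤-Reasoning
  open +-*-Solver using (solve; _:=_; _:+_; _:*_; _:-_; con)
  scale : ∀ {c r n m} → c * r ≡ 1ℚ → 0ℚ ≤ r → c * n ≤ m → n ≤ r * m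
  scale {c} {r} {n} {m} c*r 0≤r le = begin
    n              ≡⟨ *-identityˡ n ⟨
    1ℚ * n         ≡⟨ cong (_* n) c*r ⟨
    c * r * n      ≡⟨ solve 3 (λ c r n → c :* r :* n := r :* (c :* n)) refl c r n ⟩
    r * (c * n)    ≤⟨ *-monoʳ 0≤r le ⟩
    r * m          ∎

-- Choice of the budget and assembly of the reconstructor

module _ {c ε α δ : ℚ} (c>0 : 0ℚ < c) (ε>0 : 0ℚ < ε) (α>0 : 0ℚ < α) (δ>0 : 0ℚ < δ) where

  election-correct : ∀ f → reciprocal c c>0 + (1ℚ + 1ℚ) ≤ fromℕ (suc f) * (δ * α * ε) →
    (I : Input c Connected ε) →
    ProbAtLeast (seeds (electionAlgorithm f) (Input.n I) (Input.m I))
                {{seeds≢0 (electionAlgorithm f) (Input.n I) (Input.m I)}}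
                (1ℚ - δ)
                (λ s → Reconstructs (electionAlgorithm f) I s ((1ℚ + α) * ε))
  election-correct f fuel I = event Orders good , reconstructs ,
    ≤/ ∣ event Orders good ∣ (length Orders) {{slotOrders≢[] n f}}
       (subst (λ k → (1ℚ - δ) * fromℕ (length Orders) ≤ fromℕ k) (sym (∣event∣ Orders good)) probability)
    where
    open Input I
    open Election lists f
    open ≤-Reasoning
    open +-*-Solver using (solve; _:=_; _:+_; _:*_; _:-_; con)

    -- What (1 + α)εm leaves after at most εm edges have been spent on the local joins.
    threshold : ℚ
    threshold = α * ε * fromℕ m

    good : List (Slot n) → Bool
    good o = does (fromℕ (excessCount o) ≤? threshold)

    probability : (1ℚ - δ) * fromℕ (length Orders) ≤ fromℕ (∑ Orders (λ o → ⟦ good o ⟧))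
    probability = failure-bound {δ} {α} {ε}
      (<⇒≤ δ>0) (0<fromℕ m) (reciprocal>0 c c>0) (0≤fromℕ F) (0≤fromℕ (length Orders))
      (0≤fromℕ (∑ Orders λ o → ⟦ not (good o) ⟧)) fuel (vertices≤ c>0 I) (fromℕ-mono edges≤m)
      (markov Orders excessCount (0≤* (<⇒≤ (*-pos α>0 ε>0)) (0≤fromℕ m)))
      (subst₂ _≤_ (fromℕ-* (∑ Orders excessCount) F)
                  (trans (fromℕ-* (n ℕ.+ (edgeCount G ℕ.+ edgeCount G)) (length Orders))
                         (cong (_* fromℕ (length Orders))
                           (trans (fromℕ-+ n (edgeCount G ℕ.+ edgeCount G))
                                  (cong (fromℕ n +_) (fromℕ-+ (edgeCount G) (edgeCount G))))))
                  (fromℕ-mono expected-excess))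
      (trans (sym (fromℕ-+ (∑ Orders λ o → ⟦ good o ⟧) (∑ Orders λ o → ⟦ not (good o) ⟧)))
             (cong fromℕ (∑-complement Orders good)))

    reconstructs : ∀ s → s ∈ₛ event Orders good → Reconstructs (electionAlgorithm f) I s ((1ℚ + α) * ε)
    reconstructs s s∈ = attach G (selected o)
      , attach-connected G (selected o) (selected-reaches (All.lookup (orders-⊇ _ (slots n F) refl) (∈-lookup {xs = Orders} s)))
      , /≤ (differenceCount G (attach G (selected o))) m distance
      , election-reply f I s
      where
      o = lookup Orders s
      H = proj₁ close
      d = differenceCount G H

      distance : fromℕ (differenceCount G (attach G (selected o))) ≤ (1ℚ + α) * ε * fromℕ m
      distance = begin
        fromℕ (differenceCount G (attach G (selected o)))   ≤⟨ fromℕ-mono (selected-differences o H (proj₁ (proj₂ close))) ⟩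
        fromℕ (d ℕ.+ excessCount o)                         ≡⟨ fromℕ-+ d (excessCount o) ⟩
        fromℕ d + fromℕ (excessCount o)                     ≤⟨ +-mono-≤ (/≤⁻ d m (proj₂ (proj₂ close)))
                                                                        (T-does⁻ (fromℕ (excessCount o) ≤? threshold) (∈-event Orders good s s∈)) ⟩
        ε * fromℕ m + α * ε * fromℕ m                       ≡⟨ expand ε α (fromℕ m) ⟩
        (1ℚ + α) * ε * fromℕ m                              ∎
        where
        expand : ∀ e a m → e * m + a * e * m ≡ (1ℚ + a) * e * m
        expand = solve 3 (λ e a m → e :* m :+ a :* e :* m := (con 1ℚ :+ a) :* e :* m) refl

  -- Replacing `G` by the star changes at most m + n ≤ (1 + 1/c)m pairs, which is within αεm for
  -- such large αε.
  star-correct : reciprocal c c>0 + (1ℚ + 1ℚ) ≤ α * ε → (I : Input c Connected ε) → ∀ s →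
                 Reconstructs starAlgorithm I s ((1ℚ + α) * ε)
  star-correct large I s = star , star-connected , /≤ (differenceCount G star) m distance , λ u v → refl
    where
    open Input I
    open ≤-Reasoning
    open +-*-Solver using (solve; _:=_; _:+_; _:*_; _:-_; con)

    scale : ∀ {n m r} → 0ℚ ≤ m → n ≤ r * m → r + (1ℚ + 1ℚ) ≤ α * ε → m + n ≤ (1ℚ + α) * ε * m
    scale {n} {m} {r} 0≤m n≤ large = begin
      m + n                         ≤⟨ +-monoʳ-≤ m n≤ ⟩
      m + r * m                     ≡⟨ +-identityʳ (m + r * m) ⟨
      m + r * m + 0ℚ                ≤⟨ +-monoʳ-≤ (m + r * m) 0≤m ⟩
      m + r * m + m                 ≡⟨ solve 2 (λ r m → m :+ r :* m :+ m := (r :+ (con 1ℚ :+ con 1ℚ)) :* m) refl r m ⟩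
      (r + (1ℚ + 1ℚ)) * m           ≤⟨ *-monoˡ 0≤m large ⟩
      α * ε * m                     ≡⟨ +-identityˡ (α * ε * m) ⟨
      0ℚ + α * ε * m                ≤⟨ +-monoˡ-≤ (α * ε * m) (0≤* (<⇒≤ ε>0) 0≤m) ⟩
      ε * m + α * ε * m             ≡⟨ solve 3 (λ e a m → e :* m :+ a :* e :* m := (con 1ℚ :+ a) :* e :* m) refl ε α m ⟩
      (1ℚ + α) * ε * m              ∎

    distance : fromℕ (differenceCount G star) ≤ (1ℚ + α) * ε * fromℕ m
    distance = ≤-trans (fromℕ-mono (ℕ.≤-trans (star-differences G) (ℕ.+-monoˡ-≤ n edges≤m)))
      (subst (_≤ (1ℚ + α) * ε * fromℕ m) (sym (fromℕ-+ m n)) (scale {r = reciprocal c c>0} (0≤fromℕ m) (vertices≤ c>0 I) large))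

  ReconstructorWithin : ℚ → Set
  ReconstructorWithin q = Σ[ R ∈ Algorithm ] IsLocalReconstructor c Connected ε ((1ℚ + α) * ε) δ R
                                                    × QueryComplexity≤ c Connected ε R q

  star-reconstructor : ∀ {q} → 0ℚ ≤ q →
    ((I : Input c Connected ε) →
     ProbAtLeast 1 (1ℚ - δ) (λ s → Reconstructs starAlgorithm I s ((1ℚ + α) * ε))) → ReconstructorWithin q
  star-reconstructor 0≤q correct = starAlgorithm , record
    { queries-o[m] = constant-queries starAlgorithm 0 λ I s u v → z≤n
    ; correct = correct } , λ I s u v → 0≤q

  reconstructor : ReconstructorWithin ((fromℕ 4 * (reciprocal c c>0 + (1ℚ + 1ℚ))) * reciprocal (δ * α * ε) (*-pos (*-pos δ>0 α>0) ε>0))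
  reconstructor = cases (1ℚ ≤? δ) (K ≤? α * ε)
    where
    open ≤-Reasoning
    open +-*-Solver using (solve; _:=_; _:+_; _:*_; _:-_; con)

    K r p : ℚ
    -- Chosen so that K·m bounds n + 2m, and with it the number of all slots.
    K = reciprocal c c>0 + (1ℚ + 1ℚ)
    r = reciprocal (δ * α * ε) (*-pos (*-pos δ>0 α>0) ε>0)
    p = K * r

    0<K : 0ℚ < K
    0<K = subst (_< K) (+-identityˡ 0ℚ) (+-mono-<-≤ (reciprocal>0 c c>0) (0≤fromℕ 2))

    0<r : 0ℚ < r
    0<r = reciprocal>0 (δ * α * ε) (*-pos (*-pos δ>0 α>0) ε>0)

    0≤q : 0ℚ ≤ fromℕ 4 * K * r
    0≤q = 0≤* (0≤* (0≤fromℕ 4) (<⇒≤ 0<K)) (<⇒≤ 0<r)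

    x*r : δ * α * ε * r ≡ 1ℚ
    x*r = *-reciprocal (δ * α * ε) (*-pos (*-pos δ>0 α>0) ε>0)

    f : ℕ
    f = proj₁ (round-up p (*-pos 0<K 0<r))

    fuel : ∀ {k f x r} → x * r ≡ 1ℚ → 0ℚ ≤ x → k * r ≤ f → f ≤ 1ℚ + f → k ≤ (1ℚ + f) * x
    fuel {k} {f} {x} {r} x*r 0≤x le f≤ = begin
      k               ≡⟨ *-identityʳ k ⟨
      k * 1ℚ          ≡⟨ cong (k *_) x*r ⟨
      k * (x * r)     ≡⟨ solve 3 (λ k x r → k :* (x :* r) := k :* r :* x) refl k x r ⟩
      k * r * x       ≤⟨ *-monoˡ 0≤x (≤-trans le f≤) ⟩
      (1ℚ + f) * x    ∎

    enough : K ≤ fromℕ (suc f) * (δ * α * ε)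
    enough = subst (λ F → K ≤ F * (δ * α * ε)) (sym (fromℕ-+ 1 f))
      (fuel x*r (<⇒≤ (*-pos (*-pos δ>0 α>0) ε>0)) (proj₁ (proj₂ (round-up p (*-pos 0<K 0<r))))
            (subst (fromℕ f ≤_) (fromℕ-+ 1 f) (fromℕ-mono (ℕ.n≤1+n f))))

    1≤p : δ ≤ 1ℚ → α * ε ≤ K → 1ℚ ≤ p
    1≤p δ≤1 αε≤K = begin
      1ℚ                   ≡⟨ x*r ⟨
      δ * α * ε * r        ≡⟨ cong (_* r) (*-assoc δ α ε) ⟩
      δ * (α * ε) * r      ≤⟨ *-monoˡ (<⇒≤ 0<r) (*-monoˡ (<⇒≤ (*-pos α>0 ε>0)) δ≤1) ⟩
      1ℚ * (α * ε) * r     ≡⟨ cong (_* r) (*-identityˡ (α * ε)) ⟩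
      α * ε * r            ≤⟨ *-monoˡ (<⇒≤ 0<r) αε≤K ⟩
      K * r                ∎

    -- The cost is 2 + f: one look-up and F = 1 + f search queries. For p = kr ≥ 1, both 2 and f ≤ p
    -- + 1 are at most 2p; hence the constant 4.
    few : ∀ {k r f} → 1ℚ ≤ k * r → f ≤ k * r + 1ℚ → (1ℚ + 1ℚ) + f ≤ (1ℚ + 1ℚ + 1ℚ + 1ℚ) * k * r
    few {k} {r} {f} 1≤p f≤ = begin
      (1ℚ + 1ℚ) + f                          ≤⟨ +-mono-≤ (+-mono-≤ 1≤p 1≤p) (≤-trans f≤ (+-monoʳ-≤ (k * r) 1≤p)) ⟩
      (k * r + k * r) + (k * r + k * r)      ≡⟨ solve 2 (λ k r → (k :* r :+ k :* r) :+ (k :* r :+ k :* r) := (con 1ℚ :+ con 1ℚ :+ con 1ℚ :+ con 1ℚ) :* k :* r) refl k r ⟩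
      (1ℚ + 1ℚ + 1ℚ + 1ℚ) * k * r            ∎

    election : δ ≤ 1ℚ → α * ε ≤ K → ReconstructorWithin (fromℕ 4 * K * r)
    election δ≤1 αε≤K = electionAlgorithm f , record
      { queries-o[m] = constant-queries (electionAlgorithm f) (suc (suc f)) (election-cost f)
      ; correct = election-correct f enough } ,
      λ I s u v → ≤-trans (fromℕ-mono (election-cost f I s u v))
        (subst (_≤ fromℕ 4 * K * r) (sym (fromℕ-+ 2 f)) (few {K} {r} (1≤p δ≤1 αε≤K) (proj₂ (proj₂ (round-up p (*-pos 0<K 0<r))))))

    -- If δ ≥ 1 or αε ≥ K the allowed number of queries may be below 1, so no query may be made at all;
    -- but then nothing is required, or the distance to the star is small enough.
    -- Otherwise p = K / (δαε) ≥ 1, which absorbs the rounding of F and the look-up into the factor 4.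
    cases : Dec (1ℚ ≤ δ) → Dec (K ≤ α * ε) → ReconstructorWithin (fromℕ 4 * K * r)
    cases (yes 1≤δ) _ = star-reconstructor 0≤q λ I → ∅ , (λ s s∈ → ⊥-elim (∉⊥ s∈)) ,
      subst (1ℚ - δ ≤_) (+-inverseʳ 1ℚ) (+-monoʳ-≤ 1ℚ (neg-antimono-≤ 1≤δ))
    cases (no _) (yes large) = star-reconstructor 0≤q λ I → inside ∷ [] , (λ s _ → star-correct large I s) ,
      subst (1ℚ - δ ≤_) (+-identityʳ 1ℚ) (+-monoʳ-≤ 1ℚ (neg-antimono-≤ (<⇒≤ δ>0)))
    cases (no 1≰δ) (no K≰αε) = election (<⇒≤ (≰⇒> 1≰δ)) (<⇒≤ (≰⇒> K≰αε))

mainTheorem2 : (c : ℚ) → 0ℚ < c →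
    Σ[ C ∈ ℚ ]
    ((ε α δ : ℚ) (ε>0 : 0ℚ < ε) (α>0 : 0ℚ < α) (δ>0 : 0ℚ < δ) →
    Σ[ R ∈ Algorithm ]
    (IsLocalReconstructor c Connected ε ((1ℚ + α) * ε) δ R
    × QueryComplexity≤ c Connected ε R
    (C * reciprocal (δ * α * ε) (*-pos (*-pos δ>0 α>0) ε>0))))
mainTheorem2 c c>0 = fromℕ 4 * (reciprocal c c>0 + (1ℚ + 1ℚ)) , λ ε α δ ε>0 α>0 δ>0 → reconstructor c>0 ε>0 α>0 δ>0
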